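{- Let $\Phi$ be an epimorphism of a finite thick generalized quadrangle $\mathcal{S}$ of order $(s,t)$ onto a grid $\mathcal{G}$ of order $(s',1)$. Then $s'=1$, and exactly two classes of epimorphisms $\Phi$ occur, up to a suitable permutation of the points of $\mathcal{G}$; that is, after suitably naming the points of $\mathcal{G}$, $\Phi$ is as in (a) or (b) below, and both classes occur. (a) The points of $\mathcal{G}$ are $\overline{a},\overline{b},\overline{c},\overline{d}$, with $\overline{a}\sim\overline{b}\sim\overline{c}\sim\overline{d}\sim\overline{a}$; put $\widetilde{A}=\Phi^{ -1}(\overline{a})$, $\widetilde{B}=\Phi^{ -1}(\overline{b})$, $\widetilde{C}=\Phi^{ -1}(\overline{c})$, $\widetilde{D}=\Phi^{ -1}(\overline{d})$. There is a line $L$ of $\mathcal{S}$ such that $(\widetilde{A},\widetilde{B})$, with $1\le|\widetilde{A}|\le s$ and $1\le|\widetilde{B}|\le s$, is a partition of the set of all points incident with $L$; $\widetilde{C}$ consists of the points not incident with $L$ but collinear with a point of $\widetilde{B}$; and $\widetilde{D}$ consists of the points not incident with $L$ but collinear with a point of $\widetilde{A}$. Further, $\Phi^{ -1}(\overline{a}\overline{b})=\{L\}$; $\Phi^{ -1}(\overline{b}\overline{c})$ is the set of all lines distinct from $L$ but incident with a point of $\widetilde{B}$; $\Phi^{ -1}(\overline{a}\overline{d})$ is the set of all lines distinct from $L$ but incident with a point of $\widetilde{A}$; and $\Phi^{ -1}(\overline{c}\overline{d})$ consists of all lines incident with at least one point of $\widetilde{C}$ and at least one point of $\widetilde{D}$.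 (b) The dual of (a), i.e. $\Phi$, regarded as an epimorphism from the point-line dual of $\mathcal{S}$ onto the point-line dual of $\mathcal{G}$, is as in (a).
   Context: A point-line geometry is a weak generalized $m$-gon ($m\ge 3$) if any two elements (points or lines) lie in a common ordinary sub $m$-gon and there are no ordinary sub $k$-gons for $2\le k<m$; it is thick (a generalized $m$-gon) if every point is on at least three lines and every line has at least three points. Generalized quadrangles are the case $m=4$. Order $(u,v)$ means that each line is incident with $u+1$ points and each point with $v+1$ lines. A grid of order $(s',1)$, $s'\ge 1$, is a thin (i.e. weak and not thick) generalized $4$-gon of order $(s',1)$. $x\sim y$ means that the points $x,y$ are collinear, and $\overline{x}\overline{y}$ denotes the line joining distinct collinear points. A morphism maps points to points, lines to lines, and preserves incidence. An epimorphism is a morphism that is surjective on points and surjective on lines (surjectivity on incident point-line pairs is not required). The point-line dual is obtained by interchanging points and lines. -}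

module Defs where

open import Data.Nat using (ℕ; suc; _≤_; _<_)
open import Data.Nat.DivMod using (_mod_)
open import Data.Fin using (Fin; toℕ)
open import Data.Product using (Σ-syntax; ∃; ∃-syntax; _×_)
open import Data.Sum using (_⊎_; inj₁; inj₂)
open import Function.Base using (flip)
open import Function.Bundles using (_↔_; _⇔_)
open import Function.Definitions using (Injective; Surjective)
open import Relation.Nullary using (¬_)
open import Relation.Unary using (Pred; _≐_; _⊥_; _∪_)
open import Relation.Binary.PropositionalEquality using (_≡_; _≢_)
open import Level using (0ℓ)

HasSize : {X : Set} → Pred X 0ℓ → ℕ → Set
HasSize {X} P n =
  Σ[ f ∈ (Fin n → X) ] Injective _≡_ _≡_ f × (∀ x → P x ⇔ (∃[ i ] f i ≡ x))

HasAtLeast : {X : Set} → ℕ → Pred X 0ℓ → Set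
HasAtLeast {X} n P =
  Σ[ f ∈ (Fin n → X) ] Injective _≡_ _≡_ f × (∀ i → P (f i))

record Geometry : Set₁ where
  infix 4 _I_
  field
    Point : Set
    Line  : Set
    _I_   : Point → Line → Set

  Element : Set
  Element = Point ⊎ Line

  infix 4 _~_
  _~_ : Point → Point → Set
  x ~ y = ∃[ L ] (x I L × y I L)

  pointsOn : Line → Pred Point 0ℓ
  pointsOn L x = x I L

  linesThrough : Point → Pred Line 0ℓ
  linesThrough x L = x I L

  HasOrder : ℕ → ℕ → Set
  HasOrder u v = (∀ L → HasSize (pointsOn L) (suc u))
               × (∀ x → HasSize (linesThrough x) (suc v))

  IsThick : Set
  IsThick = (∀ x → HasAtLeast 3 (linesThrough x))
          × (∀ L → HasAtLeast 3 (pointsOn L))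

  IsFinite : Set
  IsFinite = (∃[ n ] (Point ↔ Fin n)) × (∃[ n ] (Line ↔ Fin n))

open Geometry using (Point; Line; Element; HasOrder; IsThick; IsFinite)

dual : Geometry → Geometry
dual S = record { Point = Line S ; Line = Point S ; _I_ = flip (Geometry._I_ S) }

record Morphism (S G : Geometry) : Set where
  private
    module S = Geometry S
    module G = Geometry G
  field
    onPoints  : S.Point → G.Point
    onLines   : S.Line → G.Line
    preserves : ∀ {x L} → x S.I L → onPoints x G.I onLines L

open Morphism

dualMorphism : ∀ {S G} → Morphism S G → Morphism (dual S) (dual G)
dualMorphism Φ = record
  { onPoints = onLines Φ ; onLines = onPoints Φ ; preserves = preserves Φ }

IsEpimorphism : ∀ {S G} → Morphism S G → Set
IsEpimorphism Φ = Surjective _≡_ _≡_ (onPoints Φ) × Surjective _≡_ _≡_ (onLines Φ)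

cyclicSuc : ∀ {k} → Fin k → Fin k
cyclicSuc {suc k} i = suc (toℕ i) mod suc k

-- Side j of the k-gon joins the vertices j and j + 1 (mod k).
ordinaryGon : ℕ → Geometry
ordinaryGon k = record
  { Point = Fin k
  ; Line  = Fin k
  ; _I_   = λ i j → (i ≡ j) ⊎ (i ≡ cyclicSuc j)
  }

-- A sub k-gon has k distinct vertices and k distinct sides.  Incidences of G
-- between a vertex and a non-adjacent side are not forbidden here; in a weak
-- generalized m-gon they cannot occur for k = m, since they would create a
-- sub k'-gon with 2 ≤ k' < m.
record SubGon (k : ℕ) (G : Geometry) : Set where
  field
    embedding         : Morphism (ordinaryGon k) G
    verticesDistinct  : Injective _≡_ _≡_ (onPoints embedding)
    sidesDistinct     : Injective _≡_ _≡_ (onLines embedding)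

  Contains : Element G → Set
  Contains (inj₁ x) = ∃[ i ] onPoints embedding i ≡ x
  Contains (inj₂ L) = ∃[ j ] onLines embedding j ≡ L

-- Without `nonempty` the empty geometry would qualify, vacuously of every order.
record IsWeakGeneralizedPolygon (m : ℕ) (G : Geometry) : Set where
  field
    nonempty     : Element G
    commonGon    : ∀ (x y : Element G) →
                   Σ[ γ ∈ SubGon m G ] SubGon.Contains γ x × SubGon.Contains γ y
    noSmallerGon : ∀ k → 2 ≤ k → k < m → ¬ SubGon k G

IsGeneralizedPolygon : ℕ → Geometry → Set
IsGeneralizedPolygon m G = IsWeakGeneralizedPolygon m G × IsThick G

record IsGrid (s' : ℕ) (G : Geometry) : Set where
  field
    positive : 1 ≤ s'
    weak     : IsWeakGeneralizedPolygon 4 G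
    notThick : ¬ IsThick G
    order    : HasOrder G s' 1

record IsFiniteThickGQ (s t : ℕ) (S : Geometry) : Set where
  field
    finite     : IsFinite S
    quadrangle : IsGeneralizedPolygon 4 S
    order      : HasOrder S s t

record GQOntoGrid : Set₁ where
  field
    S         : Geometry
    s t       : ℕ
    isGQ      : IsFiniteThickGQ s t S
    G         : Geometry
    s'        : ℕ
    isGrid    : IsGrid s' G
    Φ         : Morphism S G
    epi       : IsEpimorphism Φ

fibre : {X Y : Set} → (X → Y) → Y → Pred X 0ℓ
fibre f y x = f x ≡ y

-- Here s is one less than the number of points on a line of S.  Lines of G
-- joining two distinct points are unique (there is no sub 2-gon), so the
-- fields ab, bc, cd, ad are the lines joining the named points.
record AsInA {S G : Geometry} (s : ℕ) (Φ : Morphism S G) : Set where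
  private
    module S = Geometry S
    module G = Geometry G
  open S using (_~_) renaming (_I_ to _IS_)
  open G using () renaming (_I_ to _IG_)
  field
    a b c d : G.Point
    a≢b : a ≢ b
    a≢c : a ≢ c
    a≢d : a ≢ d
    b≢c : b ≢ c
    b≢d : b ≢ d
    c≢d : c ≢ d
    allPoints : ∀ x → x ≡ a ⊎ x ≡ b ⊎ x ≡ c ⊎ x ≡ d

    ab bc cd ad : G.Line
    joins-ab : a IG ab × b IG ab
    joins-bc : b IG bc × c IG bc
    joins-cd : c IG cd × d IG cd
    joins-ad : a IG ad × d IG ad

  Ã = fibre (onPoints Φ) a
  B̃ = fibre (onPoints Φ) b
  C̃ = fibre (onPoints Φ) c
  D̃ = fibre (onPoints Φ) d

  field
    L : S.Line

    sizeÃ : ∃[ n ] (HasSize Ã n × 1 ≤ n × n ≤ s)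
    sizeB̃ : ∃[ n ] (HasSize B̃ n × 1 ≤ n × n ≤ s)
    partition-covers   : S.pointsOn L ≐ Ã ∪ B̃
    partition-disjoint : Ã ⊥ B̃

    fibre-c : C̃ ≐ (λ x → ¬ (x IS L) × (∃[ y ] (B̃ y × x ~ y)))
    fibre-d : D̃ ≐ (λ x → ¬ (x IS L) × (∃[ y ] (Ã y × x ~ y)))

    fibre-ab : fibre (onLines Φ) ab ≐ (λ M → M ≡ L)
    fibre-bc : fibre (onLines Φ) bc ≐ (λ M → M ≢ L × (∃[ y ] (B̃ y × y IS M)))
    fibre-ad : fibre (onLines Φ) ad ≐ (λ M → M ≢ L × (∃[ y ] (Ã y × y IS M)))
    fibre-cd : fibre (onLines Φ) cd ≐
               (λ M → (∃[ x ] (C̃ x × x IS M)) × (∃[ y ] (D̃ y × y IS M)))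

ClassA : GQOntoGrid → Set
ClassA E = AsInA (GQOntoGrid.s E) (GQOntoGrid.Φ E)

-- The dual of S has order (t , s), so t takes over the role of s.
ClassB : GQOntoGrid → Set
ClassB E = AsInA (GQOntoGrid.t E) (dualMorphism (GQOntoGrid.Φ E))

{-# OPTIONS --safe #-}

-- Cutting a grid along the two lines at one of its points sorts the lines of S into two classes of
-- rows and two of columns, and the points into four cells.  Projection between opposite lines and
-- opposite points shows that the number n j of points of a row line in column j, the number m i of
-- points of a column line in row i and the number r i j of row lines at a point of cell i j are
-- constants, with r i j + r (not i) (not j) = t + 1.  The cell i j then has n j · r i (not j) · m i
-- points, and comparing the sum of these with (s + 1)(1 + st) gives an equation that is affine in
-- each unknown and whose two sides differ by a sum of nonnegative products.  All products vanish, so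
-- some class of rows or columns, or some cell, is a singleton.  If s' ≥ 2, all r i j are equal to
-- (t + 1) / 2 > 1, which is impossible.  If s' = 1, a line that is alone in its fibre gives (a) and,
-- dually, a point that is alone in its fibre gives (b).
--
-- An example in only one class needs a partition into two parts of size at least 2.  The quadrangle
-- of order (2 , 4) has five lines on a point, which are split into two and three.

module Submission where

open import Defs
open import Data.Bool using (Bool; true; false; not; if_then_else_)
import Data.Bool.Properties as Bool
open import Data.Nat using (ℕ; zero; suc; pred; _+_; _*_; _≤_; _<_; z≤n; s≤s; s≤s⁻¹)
open import Data.Nat.Properties using
  ( suc-injective; +-identityʳ; +-comm; +-suc; +-cancelˡ-≡; *-identityʳ; *-comm; *-distribˡ-+
  ; m+n≡0⇒m≡0; m+n≡0⇒n≡0; m*n≡0⇒m≡0∨n≡0; m<n⇒n≢0; ≤-refl; ≤-trans; <⇒≤; >⇒≢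
  ; +-*-semiring; +-0-commutativeMonoid)
import Data.Nat.Properties as ℕ
open import Data.Nat.Tactic.RingSolver using (solve-∀)
open import Algebra.Properties.Semiring.Sum +-*-semiring
  using (sum; sum-cong-≗; sum-replicate-zero; *-distribʳ-sum)
open import Algebra.Properties.CommutativeMonoid.Sum +-0-commutativeMonoid
  using (∑-comm; ∑-distrib-+)
open import Data.Fin using (Fin; zero; suc; #_; inject≤)
import Data.Fin.Properties as Fin
open import Data.Vec using (Vec; []; _∷_; lookup)
open import Data.Vec.Relation.Unary.All using ([]; _∷_)
open import Data.Vec.Relation.Unary.AllPairs using ([]; _∷_)
open import Data.Vec.Relation.Unary.Unique.Propositional using (Unique)
open import Data.Vec.Relation.Unary.Unique.Propositional.Properties using (lookup-injective)
open import Data.Product using (Σ-syntax; ∃; ∃!; ∃₂; ∃-syntax; _×_; _,_; proj₁; proj₂; swap)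
open import Data.Product.Properties using (≡-dec)
open import Data.Product.Function.NonDependent.Propositional using (_×-↔_)
open import Data.Sum as Sum using (_⊎_; inj₁; inj₂)
open import Data.Empty using (⊥; ⊥-elim)
open import Data.Unit using (tt)
open import Function.Base using (_∘_; id; flip; case_of_)
open import Function.Bundles using (_↔_; _⇔_; Inverse; Equivalence; mk⇔)
open import Function.Construct.Composition using (_↔-∘_)
open import Function.Construct.Symmetry using (↔-sym)
open import Function.Definitions using (Injective; Surjective)
open import Level using (0ℓ)
open import Relation.Nullary
  using (¬_; Dec; yes; no; does; contradiction; ¬?; _×-dec_; _⊎-dec_; _→-dec_)
open import Relation.Nullary.Decidable using (map′; decidable-stable; from-yes; toWitness)
open import Relation.Unary using (Pred; Decidable)
open import Relation.Binary.PropositionalEquality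

open Geometry using (Point; Line; Element; HasOrder; IsFinite)
open Morphism

-- Counting in finite types

⟦_⟧ : {A : Set} → Dec A → ℕ
⟦ a? ⟧ = if does a? then 1 else 0

⟦⟧-yes : {A : Set} (a? : Dec A) → A → ⟦ a? ⟧ ≡ 1
⟦⟧-yes (yes _) _ = refl
⟦⟧-yes (no ¬a) a = contradiction a ¬a

⟦⟧-no : {A : Set} (a? : Dec A) → ¬ A → ⟦ a? ⟧ ≡ 0
⟦⟧-no (yes a) ¬a = contradiction a ¬a
⟦⟧-no (no _)  _  = refl

⟦⟧-cong : {A B : Set} (a? : Dec A) (b? : Dec B) → (A → B) → (B → A) → ⟦ a? ⟧ ≡ ⟦ b? ⟧
⟦⟧-cong (yes a) b? f _ = sym (⟦⟧-yes b? (f a))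
⟦⟧-cong (no ¬a) b? _ g = sym (⟦⟧-no b? (¬a ∘ g))

⟦⟧-× : {A B : Set} (a? : Dec A) (b? : Dec B) → ⟦ a? ×-dec b? ⟧ ≡ ⟦ a? ⟧ * ⟦ b? ⟧
⟦⟧-× (yes _) (yes _) = refl
⟦⟧-× (yes _) (no _)  = refl
⟦⟧-× (no _)  _       = refl

⟦⟧-split : {A B : Set} (a? : Dec A) (b? : Dec B) →
           ⟦ a? ⟧ ≡ ⟦ a? ×-dec b? ⟧ + ⟦ a? ×-dec ¬? b? ⟧
⟦⟧-split (yes _) (yes _) = refl
⟦⟧-split (yes _) (no _)  = refl
⟦⟧-split (no _)  _       = refl

sum-zero : ∀ {n} (f : Fin n → ℕ) → (∀ i → f i ≡ 0) → sum f ≡ 0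
sum-zero {n} f f≡0 = trans (sum-cong-≗ f≡0) (sum-replicate-zero n)

sum-single : ∀ {n} (f : Fin n → ℕ) k → f k ≡ 1 → (∀ i → i ≢ k → f i ≡ 0) → sum f ≡ 1
sum-single f zero    fk≡1 f≡0 =
  cong₂ _+_ fk≡1 (sum-zero (f ∘ suc) λ i → f≡0 (suc i) λ ())
sum-single f (suc k) fk≡1 f≡0 =
  cong₂ _+_ (f≡0 zero λ ()) (sum-single (f ∘ suc) k fk≡1 λ i i≢k → f≡0 (suc i) (i≢k ∘ Fin.suc-injective))

Finite : Set → Set
Finite X = ∃[ n ] (X ↔ Fin n)

finiteFin : ∀ n → Finite (Fin n)
finiteFin n = n , record
  { to = id ; from = id ; to-cong = id ; from-cong = id ; inverse = id , id }

∃? : {X : Set} → Finite X → {P : Pred X 0ℓ} → Decidable P → Dec (∃ P)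
∃? (n , e) {P} P? = map′
  (λ (i , p) → Inverse.from e i , p)
  (λ (x , p) → Inverse.to e x , subst P (sym (Inverse.strictlyInverseʳ e x)) p)
  (Fin.any? (P? ∘ Inverse.from e))

count : {X : Set} → Finite X → {P : Pred X 0ℓ} → Decidable P → ℕ
count (n , e) P? = sum λ i → ⟦ P? (Inverse.from e i) ⟧

module _ {X : Set} (fin : Finite X) where
  private
    e    = proj₂ fin
    to   = Inverse.to e
    from = Inverse.from e

  count-cong : {P Q : Pred X 0ℓ} (P? : Decidable P) (Q? : Decidable Q) →
               (∀ {x} → P x → Q x) → (∀ {x} → Q x → P x) → count fin P? ≡ count fin Q?
  count-cong P? Q? f g = sum-cong-≗ λ i → ⟦⟧-cong (P? (from i)) (Q? (from i)) f g

  count-split : {P Q : Pred X 0ℓ} (P? : Decidable P) (Q? : Decidable Q) →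
                count fin P? ≡ count fin (λ x → P? x ×-dec Q? x)
                             + count fin (λ x → P? x ×-dec ¬? (Q? x))
  count-split P? Q? = trans
    (sum-cong-≗ λ i → ⟦⟧-split (P? (from i)) (Q? (from i)))
    (∑-distrib-+ (λ i → ⟦ P? (from i) ×-dec Q? (from i) ⟧)
                 (λ i → ⟦ P? (from i) ×-dec ¬? (Q? (from i)) ⟧))

  count-unique : {P : Pred X 0ℓ} (P? : Decidable P) → ∃! _≡_ P → count fin P? ≡ 1
  count-unique {P} P? (a , Pa , unique) = sum-single _ (to a)
    (⟦⟧-yes (P? _) (subst P (sym (Inverse.strictlyInverseʳ e a)) Pa))
    λ i i≢a → ⟦⟧-no (P? _) λ Pi →
      i≢a (trans (sym (Inverse.strictlyInverseˡ e i)) (cong to (sym (unique Pi))))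

  module _ (_≟_ : ∀ (x y : X) → Dec (x ≡ y)) {P : Pred X 0ℓ} (P? : Decidable P) where

    count-remove : ∀ a → P a → count fin P? ≡ suc (count fin (λ x → P? x ×-dec ¬? (x ≟ a)))
    count-remove a Pa = trans (count-split P? (_≟ a))
      (cong (_+ count fin (λ x → P? x ×-dec ¬? (x ≟ a)))
        (count-unique (λ x → P? x ×-dec (x ≟ a)) (a , (Pa , refl) , sym ∘ proj₂)))

    count-positive : ∀ a → P a → 1 ≤ count fin P?
    count-positive a Pa = subst (1 ≤_) (sym (count-remove a Pa)) (s≤s z≤n)

  count≡1⇒unique : (∀ (x y : X) → Dec (x ≡ y)) → {P : Pred X 0ℓ} (P? : Decidable P) →
                   count fin P? ≡ 1 → ∀ a b → P a → P b → a ≡ b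
  count≡1⇒unique _≟_ P? one a b Pa Pb with b ≟ a
  ... | yes b≡a = sym b≡a
  ... | no  b≢a = contradiction
    (suc-injective (trans (sym (count-remove _≟_ P? a Pa)) one))
    (m<n⇒n≢0 (count-positive _≟_ (λ x → P? x ×-dec ¬? (x ≟ a)) b (Pb , b≢a)))

-- Both sides count the pairs `x`, `y` with `P x`, `Q y` and `R x y`, once by `x` and once by `y`.
double-count : {X Y : Set} (finX : Finite X) (finY : Finite Y)
  {P : Pred X 0ℓ} {Q : Pred Y 0ℓ} {R : X → Y → Set} →
  (P? : Decidable P) (Q? : Decidable Q) (R? : ∀ x y → Dec (R x y)) → ∀ {k l} →
  (∀ x → P x → count finY (λ y → Q? y ×-dec R? x y) ≡ k) →
  (∀ y → Q y → count finX (λ x → P? x ×-dec R? x y) ≡ l) →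
  count finX P? * k ≡ count finY Q? * l
double-count finX finY P? Q? R? {k} {l} degX degY = begin
  count finX P? * k
    ≡⟨ *-distribʳ-sum k (λ i → ⟦ P? (x i) ⟧) ⟩
  sum (λ i → ⟦ P? (x i) ⟧ * k)
    ≡⟨ sum-cong-≗ (λ i → weigh (P? (x i)) (degX (x i))) ⟩
  sum (λ i → ⟦ P? (x i) ⟧ * sum (λ j → ⟦ Q? (y j) ×-dec R? (x i) (y j) ⟧))
    ≡⟨ sum-cong-≗ (λ i → pull ⟦ P? (x i) ⟧ (λ j → ⟦ Q? (y j) ×-dec R? (x i) (y j) ⟧)) ⟩
  sum (λ i → sum (λ j → ⟦ P? (x i) ⟧ * ⟦ Q? (y j) ×-dec R? (x i) (y j) ⟧))
    ≡⟨ ∑-comm (λ i j → ⟦ P? (x i) ⟧ * ⟦ Q? (y j) ×-dec R? (x i) (y j) ⟧) ⟩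
  sum (λ j → sum (λ i → ⟦ P? (x i) ⟧ * ⟦ Q? (y j) ×-dec R? (x i) (y j) ⟧))
    ≡⟨ sum-cong-≗ (λ j → sum-cong-≗ (λ i → exchange (P? (x i)) (Q? (y j)) (R? (x i) (y j)))) ⟩
  sum (λ j → sum (λ i → ⟦ Q? (y j) ⟧ * ⟦ P? (x i) ×-dec R? (x i) (y j) ⟧))
    ≡⟨ sum-cong-≗ (λ j → pull ⟦ Q? (y j) ⟧ (λ i → ⟦ P? (x i) ×-dec R? (x i) (y j) ⟧)) ⟨
  sum (λ j → ⟦ Q? (y j) ⟧ * sum (λ i → ⟦ P? (x i) ×-dec R? (x i) (y j) ⟧))
    ≡⟨ sum-cong-≗ (λ j → weigh (Q? (y j)) (degY (y j))) ⟨
  sum (λ j → ⟦ Q? (y j) ⟧ * l)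
    ≡⟨ *-distribʳ-sum l (λ j → ⟦ Q? (y j) ⟧) ⟨
  count finY Q? * l ∎
  where
  open ≡-Reasoning
  x = Inverse.from (proj₂ finX)
  y = Inverse.from (proj₂ finY)

  weigh : {A : Set} (a? : Dec A) → ∀ {m n} → (A → n ≡ m) → ⟦ a? ⟧ * m ≡ ⟦ a? ⟧ * n
  weigh (yes a) n≡m = cong (_+ 0) (sym (n≡m a))
  weigh (no _)  _   = refl

  pull : ∀ {n} a (f : Fin n → ℕ) → a * sum f ≡ sum (λ i → a * f i)
  pull a f = trans (*-comm a (sum f))
    (trans (*-distribʳ-sum a f) (sum-cong-≗ λ i → *-comm (f i) a))

  exchange : {A B C : Set} (a? : Dec A) (b? : Dec B) (c? : Dec C) →
             ⟦ a? ⟧ * ⟦ b? ×-dec c? ⟧ ≡ ⟦ b? ⟧ * ⟦ a? ×-dec c? ⟧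
  exchange a? b? c? = begin
    ⟦ a? ⟧ * ⟦ b? ×-dec c? ⟧      ≡⟨ cong (⟦ a? ⟧ *_) (⟦⟧-× b? c?) ⟩
    ⟦ a? ⟧ * (⟦ b? ⟧ * ⟦ c? ⟧)    ≡⟨ swap-factors ⟦ a? ⟧ ⟦ b? ⟧ ⟦ c? ⟧ ⟩
    ⟦ b? ⟧ * (⟦ a? ⟧ * ⟦ c? ⟧)    ≡⟨ cong (⟦ b? ⟧ *_) (⟦⟧-× a? c?) ⟨
    ⟦ b? ⟧ * ⟦ a? ×-dec c? ⟧      ∎
    where
    swap-factors : ∀ p q r → p * (q * r) ≡ q * (p * r)
    swap-factors = solve-∀

-- Images are given by a relation and unique existence because they come from projection, which
-- takes a proof of non-incidence and hence is no function on all of `X`.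
module _ {X Y : Set} (finX : Finite X) (finY : Finite Y)
  {P : Pred X 0ℓ} {Q : Pred Y 0ℓ} {R : X → Y → Set}
  (P? : Decidable P) (Q? : Decidable Q) (R? : ∀ x y → Dec (R x y))
  (image : ∀ x → P x → ∃! _≡_ (λ y → Q y × R x y)) where

  count-fibres : ∀ {l} → (∀ y → Q y → count finX (λ x → P? x ×-dec R? x y) ≡ l) →
                 count finX P? ≡ count finY Q? * l
  count-fibres {l} fibre-size = begin
    count finX P?     ≡⟨ *-identityʳ _ ⟨
    count finX P? * 1 ≡⟨ double-count finX finY P? Q? R?
                           (λ x Px → count-unique finY (λ y → Q? y ×-dec R? x y) (image x Px)) fibre-size ⟩
    count finY Q? * l ∎
    where open ≡-Reasoning

  count-bijection : (∀ y → Q y → ∃! _≡_ (λ x → P x × R x y)) → count finX P? ≡ count finY Q?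
  count-bijection preimage = trans
    (count-fibres λ y Qy → count-unique finX (λ x → P? x ×-dec R? x y) (preimage y Qy))
    (*-identityʳ _)

count-bool : {X : Set} (fin : Finite X) {P : Pred X 0ℓ} (P? : Decidable P) (f : X → Bool) →
  count fin P? ≡ count fin (λ x → P? x ×-dec (f x Bool.≟ false))
               + count fin (λ x → P? x ×-dec (f x Bool.≟ true))
count-bool fin P? f = trans (count-split fin P? (λ x → f x Bool.≟ false))
  (cong (count fin (λ x → P? x ×-dec (f x Bool.≟ false)) +_)
    (count-cong fin (λ x → P? x ×-dec ¬? (f x Bool.≟ false)) (λ x → P? x ×-dec (f x Bool.≟ true))
      (λ (Px , ≢false) → Px , Bool.¬-not ≢false)
      (λ (Px , ≡true) → Px , λ ≡false → case trans (sym ≡true) ≡false of λ ())))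

every? : {X : Set} → Decidable (λ (x : X) → x ≡ x)
every? x = yes refl

count-full : ∀ n → count (finiteFin n) every? ≡ n
count-full zero    = refl
count-full (suc n) = cong suc (count-full n)

count-hasSize : {X : Set} (fin : Finite X) → (∀ (x y : X) → Dec (x ≡ y)) →
  {P : Pred X 0ℓ} (P? : Decidable P) → ∀ {n} → HasSize P n → count fin P? ≡ n
count-hasSize fin _≟_ P? {n} (f , f-inj , P⇔f) = trans
  (count-bijection fin (finiteFin n) P? every? (λ x i → f i ≟ x)
    (λ x Px → let (i , fi≡x) = Equivalence.to (P⇔f x) Px in
      i , (refl , fi≡x) , λ (_ , fj≡x) → f-inj (trans fi≡x (sym fj≡x)))
    (λ i _ → f i , (Equivalence.from (P⇔f (f i)) (i , refl) , refl) , proj₂))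
  (count-full n)

-- The arithmetic of the cell sizes

-- There is a 2 × 2 table of natural numbers with row sums `x₀`, `x₁` and column sums `y₀`, `y₁`; it
-- is filled greedily from the first entry.
refinement : ∀ x₀ x₁ {y₀ y₁} → x₀ + x₁ ≡ y₀ + y₁ →
  ∃₂ λ p q → ∃₂ λ u v → x₀ ≡ p + q × x₁ ≡ u + v × y₀ ≡ p + u × y₁ ≡ q + v
refinement zero x₁ {y₀} {y₁} eq = 0 , 0 , y₀ , y₁ , refl , eq , refl , refl
refinement (suc x₀) x₁ {zero} eq = 0 , suc x₀ , 0 , x₁ , refl , refl , refl , sym eq
refinement (suc x₀) x₁ {suc y₀} eq with refinement x₀ x₁ {y₀} (suc-injective eq)
... | p , q , u , v , refl , refl , refl , refl = suc p , q , u , v , refl , refl , refl , refl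

-- The arguments stand for one less than the constants `m i`, `n j` and `r i j`, which are positive.
-- Each summand of `cellTotal` is the size of one cell, and `excess` is the sum of the products of
-- `μ (not i)`, `a i j` and `ν j`.
cellTotal excess : (μ₀ μ₁ ν₀ ν₁ a₀₀ a₀₁ a₁₀ a₁₁ : ℕ) → ℕ
cellTotal μ₀ μ₁ ν₀ ν₁ a₀₀ a₀₁ a₁₀ a₁₁ =
    (suc ν₀ * (suc a₀₁ * suc μ₀) + suc ν₁ * (suc a₀₀ * suc μ₀))
  + (suc ν₀ * (suc a₁₁ * suc μ₁) + suc ν₁ * (suc a₁₀ * suc μ₁))
excess μ₀ μ₁ ν₀ ν₁ a₀₀ a₀₁ a₁₀ a₁₁ =
  μ₁ * (a₀₀ * ν₀ + a₀₁ * ν₁) + μ₀ * (a₁₁ * ν₁ + a₁₀ * ν₀)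

-- cellTotal is affine in each of its arguments, so its distance to the left-hand side over the box
-- cut out by the two constraints is interpolated from the corners of the box; this gives excess.
weighted-total : ∀ μ₀ μ₁ ν₀ ν₁ a₀₀ a₀₁ a₁₀ a₁₁ →
  μ₀ + μ₁ ≡ ν₀ + ν₁ → a₀₀ + a₁₁ ≡ a₀₁ + a₁₀ →
  let e = μ₀ + μ₁ ; f = a₀₀ + a₁₁ in
  e * (suc (suc e) + suc (suc e) * (suc f * suc e)) ≡
  e * cellTotal μ₀ μ₁ ν₀ ν₁ a₀₀ a₀₁ a₁₀ a₁₁
    + suc (suc e) * excess μ₀ μ₁ ν₀ ν₁ a₀₀ a₀₁ a₁₀ a₁₁
weighted-total μ₀ μ₁ ν₀ ν₁ a₀₀ a₀₁ a₁₀ a₁₁ Σμ Σa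
  with refinement μ₀ μ₁ {ν₀} {ν₁} Σμ | refinement a₀₀ a₁₁ {a₀₁} {a₁₀} Σa
... | p , q , u , v , refl , refl , refl , refl | k , l , g , h , refl , refl , refl , refl =
  identity p q u v k l g h
  where
  -- The refinements solve the two constraints without subtraction.
  identity : ∀ p q u v k l g h →
    (p + q + (u + v)) * (suc (suc (p + q + (u + v)))
      + suc (suc (p + q + (u + v))) * (suc (k + l + (g + h)) * suc (p + q + (u + v)))) ≡
    (p + q + (u + v)) *
      ((suc (p + u) * (suc (k + g) * suc (p + q)) + suc (q + v) * (suc (k + l) * suc (p + q)))
      + (suc (p + u) * (suc (g + h) * suc (u + v)) + suc (q + v) * (suc (l + h) * suc (u + v))))
    + suc (suc (p + q + (u + v))) *
      ((u + v) * ((k + l) * (p + u) + (k + g) * (q + v))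
      + (p + q) * ((g + h) * (q + v) + (l + h) * (p + u)))
  identity = solve-∀

product-vanishes : ∀ x y z → x * (y * z) ≡ 0 → x ≡ 0 ⊎ y ≡ 0 ⊎ z ≡ 0
product-vanishes x y z eq with m*n≡0⇒m≡0∨n≡0 x eq
... | inj₁ x≡0 = inj₁ x≡0
... | inj₂ yz≡0 = inj₂ (m*n≡0⇒m≡0∨n≡0 y yz≡0)

module _ (μ ν : Bool → ℕ) (a : Bool → Bool → ℕ) where

  CellTotal : ℕ
  CellTotal = cellTotal (μ false) (μ true) (ν false) (ν true)
                        (a false false) (a false true) (a true false) (a true true)

  Excess : ℕ
  Excess = excess (μ false) (μ true) (ν false) (ν true)
                  (a false false) (a false true) (a true false) (a true true)

  -- With `s = suc e` and `t = suc f` the last hypothesis equates two counts of all points.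
  -- Multiplied by `e` and compared with `weighted-total`, it leaves `suc (suc e) * Excess ≡ 0`.
  excess-vanishes : ∀ {e f} →
    μ false + μ true ≡ e → ν false + ν true ≡ e →
    a false false + a true true ≡ f → a false true + a true false ≡ f →
    suc (suc e) + suc (suc e) * (suc f * suc e) ≡ CellTotal → Excess ≡ 0
  excess-vanishes {e} {f} refl Σν refl Σa total =
    m*n≡0⇒n≡0 (suc e) (+-cancelˡ-≡ (e * CellTotal) _ _ (begin
      e * CellTotal + suc (suc e) * Excess
        ≡⟨ weighted-total (μ false) (μ true) (ν false) (ν true)
             (a false false) (a false true) (a true false) (a true true) (sym Σν) (sym Σa) ⟨
      e * (suc (suc e) + suc (suc e) * (suc f * suc e))
        ≡⟨ cong (e *_) total ⟩
      e * CellTotal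
        ≡⟨ +-identityʳ _ ⟨
      e * CellTotal + 0 ∎))
    where
    open ≡-Reasoning
    m*n≡0⇒n≡0 : ∀ m {n} → suc m * n ≡ 0 → n ≡ 0
    m*n≡0⇒n≡0 m {zero} _ = refl

  Excess-vanishing : Excess ≡ 0 → ∀ i j → μ (not i) ≡ 0 ⊎ a i j ≡ 0 ⊎ ν j ≡ 0
  Excess-vanishing eq = λ
    { false false → product-vanishes _ _ _ (zero-part (μ true) (a false false * ν false) left)
    ; false true  → product-vanishes _ _ _
        (zero-part (μ true) (a false true * ν true)
          (trans (cong (μ true *_) (+-comm _ (a false false * ν false))) left))
    ; true  true  → product-vanishes _ _ _ (zero-part (μ false) (a true true * ν true) right)
    ; true  false → product-vanishes _ _ _
        (zero-part (μ false) (a true false * ν false)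
          (trans (cong (μ false *_) (+-comm _ (a true true * ν true))) right))
    }
    where
    left  = m+n≡0⇒m≡0 (μ true * (a false false * ν false + a false true * ν true)) eq
    right = m+n≡0⇒n≡0 (μ true * (a false false * ν false + a false true * ν true)) eq
    zero-part : ∀ x y {z} → x * (y + z) ≡ 0 → x * y ≡ 0
    zero-part x y {z} xyz≡0 = m+n≡0⇒m≡0 (x * y) (trans (sym (*-distribˡ-+ x y z)) xyz≡0)

  -- The three cases will make a singleton of the row class `i`, the column class `j` and the cell
  -- `i j`. In the second, `a (not i) (not j)` appears because the points of cell `i j` lie on
  -- `r (not i) (not j)` column lines.
  Outcome : Set
  Outcome = (∃[ i ] μ i ≡ 0 × (∀ j → a i j ≡ 0))
          ⊎ (∃[ j ] ν j ≡ 0 × (∀ i → a (not i) (not j) ≡ 0))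
          ⊎ (∃₂ λ i j → μ i ≡ 0 × ν j ≡ 0 × a i (not j) ≡ 0)

  module _ (vanish : ∀ i j → μ (not i) ≡ 0 ⊎ a i j ≡ 0 ⊎ ν j ≡ 0)
           (μ≢0 : ∀ i → μ i ≡ 0 → μ (not i) ≢ 0)
           (ν≢0 : ∀ j → ν j ≡ 0 → ν (not j) ≢ 0)
           (a≢0 : ∀ i j → a i j ≡ 0 → a (not i) (not j) ≢ 0) where

    private
      thin-row : ∀ i → μ i ≡ 0 → Outcome
      thin-row i μi≡0 with vanish i false | vanish i true
      ... | inj₁ μ≡0        | _               = contradiction μ≡0 (μ≢0 i μi≡0)
      ... | _               | inj₁ μ≡0        = contradiction μ≡0 (μ≢0 i μi≡0)
      ... | inj₂ (inj₁ a≡0) | inj₂ (inj₁ b≡0) = inj₁ (i , μi≡0 , λ { false → a≡0 ; true → b≡0 })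
      ... | inj₂ (inj₁ a≡0) | inj₂ (inj₂ ν≡0) = inj₂ (inj₂ (i , true , μi≡0 , ν≡0 , a≡0))
      ... | inj₂ (inj₂ ν≡0) | inj₂ (inj₁ b≡0) = inj₂ (inj₂ (i , false , μi≡0 , ν≡0 , b≡0))
      ... | inj₂ (inj₂ ν≡0) | inj₂ (inj₂ ν≡0′) = contradiction ν≡0′ (ν≢0 false ν≡0)

      -- With every `μ i` and `ν j` nonzero, `vanish` leaves only `a i j ≡ 0` for both `i`. Then no
      -- entry `a i (not j)` vanishes, so the same products force `ν (not j) ≡ 0`.
      thick-rows : (∀ i → μ i ≢ 0) → ∀ j → ν j ≢ 0 → Outcome
      thick-rows μ≢0 j νj≢0 = inj₂ (inj₁ (not j , νj′≡0 , λ i → subst (λ k → a (not i) k ≡ 0)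
                                           (sym (Bool.not-involutive j)) (aj≡0 (not i))))
        where
        aj≡0 : ∀ i → a i j ≡ 0
        aj≡0 i with vanish i j
        ... | inj₁ μ≡0        = contradiction μ≡0 (μ≢0 (not i))
        ... | inj₂ (inj₁ a≡0) = a≡0
        ... | inj₂ (inj₂ ν≡0) = contradiction ν≡0 νj≢0

        νj′≡0 : ν (not j) ≡ 0
        νj′≡0 with vanish false (not j)
        ... | inj₁ μ≡0        = contradiction μ≡0 (μ≢0 true)
        ... | inj₂ (inj₁ a≡0) = contradiction a≡0 (a≢0 true j (aj≡0 true))
        ... | inj₂ (inj₂ ν≡0) = ν≡0

    outcome : Outcome
    outcome with μ false ℕ.≟ 0 | μ true ℕ.≟ 0 | ν false ℕ.≟ 0
    ... | yes μ≡0 | _       | _       = thin-row false μ≡0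
    ... | _       | yes μ≡0 | _       = thin-row true μ≡0
    ... | no μ≢0  | no μ≢0′ | no ν≢0  = thick-rows (λ { false → μ≢0 ; true → μ≢0′ }) false ν≢0
    ... | no μ≢0  | no μ≢0′ | yes ν≡0 = thick-rows (λ { false → μ≢0 ; true → μ≢0′ }) true (ν≢0 false ν≡0)

-- Generalized quadrangles

-- The incidence axioms of a generalized quadrangle, together with deciders. This form dualizes by
-- exchanging arguments and is easier to count with than ordinary subgons.
record Quadrangle (S : Geometry) : Set where
  open Geometry S using (_I_)
  infix 4 _≟ₚ_ _≟ₗ_ _I?_
  field
    _≟ₚ_ : (x y : Point S) → Dec (x ≡ y)
    _≟ₗ_ : (L M : Line S) → Dec (L ≡ M)
    _I?_ : ∀ x L → Dec (x I L)
    linear : ∀ {x y L M} → x I L → y I L → x I M → y I M → x ≡ y ⊎ L ≡ M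
    project : ∀ {x L} → ¬ x I L → ∃₂ λ y M → x I M × y I M × y I L
    -- Both equalities are part of the conclusion to make the axioms self-dual.
    noTriangle : ∀ {x L y z M N} → ¬ x I L →
                 x I M → y I M → y I L → x I N → z I N → z I L → y ≡ z × M ≡ N

  meet : ∀ {x y L M} → L ≢ M → x I L → y I L → x I M → y I M → x ≡ y
  meet L≢M xL yL xM yM with linear xL yL xM yM
  ... | inj₁ x≡y = x≡y
  ... | inj₂ L≡M = contradiction L≡M L≢M

  join : ∀ {x y L M} → x ≢ y → x I L → y I L → x I M → y I M → L ≡ M
  join x≢y xL yL xM yM with linear xL yL xM yM
  ... | inj₁ x≡y = contradiction x≡y x≢y
  ... | inj₂ L≡M = L≡M

dualQuadrangle : ∀ {S} → Quadrangle S → Quadrangle (dual S)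
dualQuadrangle Q = record
  { _≟ₚ_ = _≟ₗ_
  ; _≟ₗ_ = _≟ₚ_
  ; _I?_ = flip _I?_
  ; linear = λ xL yL xM yM → Sum.swap (linear xL xM yL yM)
  ; project = λ x∉L → let (y , M , xM , yM , yL) = project x∉L in M , y , yL , yM , xM
  ; noTriangle = λ x∉L xM yM yL xN zN zL →
      let (y≡z , M≡N) = noTriangle x∉L yL yM xM zL zN xN in M≡N , y≡z
  }
  where open Quadrangle Q

ordinaryQuadrangle : Quadrangle (ordinaryGon 4)
ordinaryQuadrangle = record
  { _≟ₚ_ = Fin._≟_
  ; _≟ₗ_ = Fin._≟_
  ; _I?_ = _∈?_
  ; linear = λ {x} {y} {L} {M} → from-yes (Fin.all? λ x → Fin.all? λ y → Fin.all? λ L → Fin.all? λ M →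
      (x ∈? L) →-dec (y ∈? L) →-dec (x ∈? M) →-dec (y ∈? M) →-dec ((x Fin.≟ y) ⊎-dec (L Fin.≟ M))) x y L M
  ; project = λ {x} {L} → from-yes (Fin.all? λ x → Fin.all? λ L →
      ¬? (x ∈? L) →-dec Fin.any? λ y → Fin.any? λ M → (x ∈? M) ×-dec (y ∈? M) ×-dec (y ∈? L)) x L
  ; noTriangle = λ {x} {L} {y} {z} {M} {N} → from-yes
      (Fin.all? λ x → Fin.all? λ L → Fin.all? λ y → Fin.all? λ z → Fin.all? λ M → Fin.all? λ N →
      ¬? (x ∈? L) →-dec (x ∈? M) →-dec (y ∈? M) →-dec (y ∈? L) →-dec (x ∈? N) →-dec (z ∈? N) →-dec (z ∈? L)
      →-dec ((y Fin.≟ z) ×-dec (M Fin.≟ N))) x L y z M N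
  }
  where
  open Geometry (ordinaryGon 4) using (_I_)
  _∈?_ : ∀ x L → Dec (x I L)
  x ∈? L = (x Fin.≟ L) ⊎-dec (x Fin.≟ cyclicSuc L)

gon : ∀ {S k} (xs : Vec (Point S) k) (Ls : Vec (Line S) k) → Unique xs → Unique Ls →
      (∀ j → Geometry._I_ S (lookup xs j) (lookup Ls j)) →
      (∀ j → Geometry._I_ S (lookup xs (cyclicSuc j)) (lookup Ls j)) → SubGon k S
gon xs Ls xs! Ls! start end = record
  { embedding = record
    { onPoints = lookup xs
    ; onLines = lookup Ls
    ; preserves = λ { {L = j} (inj₁ refl) → start j ; {L = j} (inj₂ refl) → end j }
    }
  ; verticesDistinct = lookup-injective xs! _ _
  ; sidesDistinct = lookup-injective Ls! _ _
  }

member? : {X : Set} → (∀ (x y : X) → Dec (x ≡ y)) → {P : Pred X 0ℓ} → ∀ {n} → HasSize P n → Decidable P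
member? _≟_ (f , _ , P⇔f) x =
  map′ (Equivalence.from (P⇔f x)) (Equivalence.to (P⇔f x)) (Fin.any? λ i → f i ≟ x)

module _ {G : Geometry} (weak : IsWeakGeneralizedPolygon 4 G) {u v} (order : HasOrder G u v) where
  open Geometry G using (_I_)
  open IsWeakGeneralizedPolygon weak
  open Morphism
  open SubGon

  private
    -- Both points are vertices of one quadrangle with distinct vertices, so equality is decided by
    -- comparing indices.
    _≟P_ : (x y : Point G) → Dec (x ≡ y)
    x ≟P y with commonGon (inj₁ x) (inj₁ y)
    ... | γ , (i , refl) , (j , refl) = map′ (cong _) (verticesDistinct γ) (i Fin.≟ j)

    _≟L_ : (L M : Line G) → Dec (L ≡ M)
    L ≟L M with commonGon (inj₂ L) (inj₂ M)
    ... | γ , (i , refl) , (j , refl) = map′ (cong _) (sidesDistinct γ) (i Fin.≟ j)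

    noDigon : ∀ {x y L M} → x ≢ y → L ≢ M → x I L → y I L → x I M → y I M → ⊥
    noDigon {x} {y} {L} {M} x≢y L≢M xL yL xM yM = noSmallerGon 2 (s≤s (s≤s z≤n)) (s≤s (s≤s (s≤s z≤n)))
      (gon (x ∷ y ∷ []) (L ∷ M ∷ []) ((x≢y ∷ []) ∷ [] ∷ []) ((L≢M ∷ []) ∷ [] ∷ [])
        (λ { zero → xL ; (suc zero) → yM }) (λ { zero → yL ; (suc zero) → xM }))

    line-unique : ∀ {x y L M} → x I L → y I L → x I M → y I M → x ≡ y ⊎ L ≡ M
    line-unique {x} {y} {L} {M} xL yL xM yM with x ≟P y | L ≟L M
    ... | yes x≡y | _       = inj₁ x≡y
    ... | _       | yes L≡M = inj₂ L≡M
    ... | no x≢y  | no L≢M  = ⊥-elim (noDigon x≢y L≢M xL yL xM yM)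

    triangle : ∀ {x L y z M N} → ¬ x I L →
               x I M → y I M → y I L → x I N → z I N → z I L → y ≢ z → ⊥
    triangle {x} {L} {y} {z} {M} {N} x∉L xM yM yL xN zN zL y≢z =
      noSmallerGon 3 (s≤s (s≤s z≤n)) ≤-refl
        (gon (x ∷ y ∷ z ∷ []) (M ∷ L ∷ N ∷ [])
          ((x≢ yL ∷ x≢ zL ∷ []) ∷ (y≢z ∷ []) ∷ [] ∷ [])
          (((L≢ xM ∘ sym) ∷ M≢N ∷ []) ∷ (L≢ xN ∷ []) ∷ [] ∷ [])
          (λ { zero → xM ; (suc zero) → yL ; (suc (suc zero)) → zN })
          (λ { zero → yM ; (suc zero) → zL ; (suc (suc zero)) → xN }))
      where
      x≢ : ∀ {w} → w I L → x ≢ w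
      x≢ wL refl = x∉L wL
      L≢ : ∀ {K} → x I K → L ≢ K
      L≢ xK refl = x∉L xK
      M≢N : M ≢ N
      M≢N refl = noDigon y≢z (L≢ xM) yL zL yM zN

  polygon⇒quadrangle : Quadrangle G
  polygon⇒quadrangle = record
    { _≟ₚ_ = _≟P_
    ; _≟ₗ_ = _≟L_
    ; _I?_ = λ x L → member? _≟P_ (proj₁ order L) x
    ; linear = line-unique
    ; project = projection
    ; noTriangle = no-triangle
    }
    where
    -- A quadrangle containing `x` and `L` already contains the projection: non-incidence is
    -- reflected to the indices, where the ordinary quadrangle supplies it.
    projection : ∀ {x L} → ¬ x I L → ∃₂ λ y M → x I M × y I M × y I L
    projection {x} {L} x∉L with commonGon (inj₁ x) (inj₂ L)
    ... | γ , (i , refl) , (j , refl) =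
      let (y , M , xM , yM , yL) = Quadrangle.project ordinaryQuadrangle (x∉L ∘ preserves (embedding γ))
      in onPoints (embedding γ) y , onLines (embedding γ) M ,
         preserves (embedding γ) xM , preserves (embedding γ) yM , preserves (embedding γ) yL

    no-triangle : ∀ {x L y z M N} → ¬ x I L →
                  x I M → y I M → y I L → x I N → z I N → z I L → y ≡ z × M ≡ N
    no-triangle {x} {L} {y} {z} x∉L xM yM yL xN zN zL
      with decidable-stable (y ≟P z) (triangle x∉L xM yM yL xN zN zL)
    ... | refl with line-unique xM yM xN zN
    ...   | inj₁ refl = contradiction yL x∉L
    ...   | inj₂ M≡N  = refl , M≡N

-- From the incidence axioms back to ordinary subgons

module _ {S : Geometry} (Q : Quadrangle S) where
  open Quadrangle Q
  open SubGon using (Contains)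
  open Geometry S using (_I_)

  -- The fourth vertex `w` is the projection of `z` onto `N`. A coincidence among the vertices or
  -- sides would give a triangle or put `x` on `L`, `z` on `N`, or two points on two lines.
  antiflag-gon : ∀ {x L y M N z} → ¬ x I L → x I M → y I M → y I L → x I N → M ≢ N → z I L → y ≢ z →
    Σ[ γ ∈ SubGon 4 S ] (Contains γ (inj₁ x) × Contains γ (inj₁ y) × Contains γ (inj₁ z))
                      × (Contains γ (inj₂ M) × Contains γ (inj₂ L) × Contains γ (inj₂ N))
  antiflag-gon {x} {L} {y} {M} {N} {z} x∉L xM yM yL xN M≢N zL y≢z =
    gon (x ∷ y ∷ z ∷ w ∷ []) (M ∷ L ∷ K ∷ N ∷ [])
      ((x≢ yL ∷ x≢ zL ∷ x≢w ∷ []) ∷ (y≢z ∷ y≢w ∷ []) ∷ (z≢w ∷ []) ∷ [] ∷ [])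
      (((L≢ xM ∘ sym) ∷ M≢K ∷ M≢N ∷ []) ∷ (L≢K ∷ L≢ xN ∷ []) ∷ (K≢N ∷ []) ∷ [] ∷ [])
      (λ { zero → xM ; (suc zero) → yL ; (suc (suc zero)) → zK ; (suc (suc (suc zero))) → wN })
      (λ { zero → yM ; (suc zero) → zL ; (suc (suc zero)) → wK ; (suc (suc (suc zero))) → xN }) ,
    ((# 0 , refl) , (# 1 , refl) , (# 2 , refl)) , ((# 0 , refl) , (# 1 , refl) , (# 3 , refl))
    where
    z∉N : ¬ z I N
    z∉N zN = y≢z (proj₁ (noTriangle x∉L xM yM yL xN zN zL))
    proj = project z∉N
    w = proj₁ proj
    K = proj₁ (proj₂ proj)
    zK = proj₁ (proj₂ (proj₂ proj))
    wK = proj₁ (proj₂ (proj₂ (proj₂ proj)))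
    wN = proj₂ (proj₂ (proj₂ (proj₂ proj)))
    x≢ : ∀ {w} → w I L → x ≢ w
    x≢ wL refl = x∉L wL
    L≢ : ∀ {K} → x I K → L ≢ K
    L≢ xK refl = x∉L xK
    x≢w : x ≢ w
    x≢w x≡w = y≢z (proj₁ (noTriangle x∉L xM yM yL (subst (_I K) (sym x≡w) wK) zK zL))
    z≢w : z ≢ w
    z≢w z≡w = z∉N (subst (_I N) (sym z≡w) wN)
    K≢N : K ≢ N
    K≢N K≡N = z∉N (subst (z I_) K≡N zK)
    y≢w : y ≢ w
    y≢w y≡w = x≢ yL (meet M≢N xM yM xN (subst (_I N) (sym y≡w) wN))
    M≢K : M ≢ K
    M≢K M≡K = L≢ xM (join y≢z yL zL yM (subst (z I_) (sym M≡K) zK))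
    L≢K : L ≢ K
    L≢K L≡K = M≢N (proj₂ (noTriangle x∉L xM yM yL xN wN (subst (w I_) (sym L≡K) wK)))

size⇒other : {X : Set} {P : Pred X 0ℓ} → (∀ (x y : X) → Dec (x ≡ y)) → ∀ {n} → HasSize P (2 + n) →
             ∀ x → ∃[ y ] P y × x ≢ y
size⇒other _≟_ (f , f-inj , P⇔f) x with x ≟ f zero
... | no x≢f0   = f zero , Equivalence.from (P⇔f _) (zero , refl) , x≢f0
... | yes refl  = f (suc zero) , Equivalence.from (P⇔f _) (suc zero , refl) , λ eq → case f-inj eq of λ ()

module _ {S : Geometry} (Q : Quadrangle S) {u v} (order : HasOrder S (suc u) (suc v)) where
  open Quadrangle Q
  open Geometry S using (_I_)

  other-point : ∀ L x → ∃[ y ] y I L × x ≢ y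
  other-point L = size⇒other _≟ₚ_ (proj₁ order L)

  other-line : ∀ x L → ∃[ M ] x I M × L ≢ M
  other-line x = size⇒other _≟ₗ_ (proj₂ order x)

  private
    CommonGon : Element S → Element S → Set
    CommonGon a b = Σ[ γ ∈ SubGon 4 S ] SubGon.Contains γ a × SubGon.Contains γ b

    -- A second line `M` on `z` misses `x`, so `x` and `M` form an antiflag in which `L` is the
    -- projecting line.
    flag-gon : ∀ {x z L} → x I L → z I L → x ≢ z →
      Σ[ γ ∈ SubGon 4 S ] (SubGon.Contains γ (inj₁ x) × SubGon.Contains γ (inj₁ z)) × SubGon.Contains γ (inj₂ L)
    flag-gon {x} {z} {L} xL zL x≢z =
      let (M , zM , L≢M) = other-line z L
          (N , xN , L≢N) = other-line x L
          (w , wM , z≢w) = other-point M z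
          (γ , (cx , cz , _) , (cL , _ , _)) =
            antiflag-gon Q (λ xM → L≢M (join x≢z xL zL xM zM)) xL zL zM xN L≢N wM z≢w
      in γ , (cx , cz) , cL

    point-point : ∀ x y → CommonGon (inj₁ x) (inj₁ y)
    point-point x y
      with proj₁ (proj₂ order y) zero | Equivalence.from (proj₂ (proj₂ (proj₂ order y)) _) (zero , refl)
    ... | L | yL with x ≟ₚ y | x I? L
    ...   | yes refl | _ =
      let (z , zL , x≢z) = other-point L x
          (γ , (cx , _) , _) = flag-gon yL zL x≢z
      in γ , cx , cx
    ...   | no x≢y | yes xL = let (γ , (cx , cy) , _) = flag-gon xL yL x≢y in γ , cx , cy
    ...   | no x≢y | no x∉L with project x∉L
    ...     | z , M , xM , zM , zL with z ≟ₚ y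
    ...       | yes refl = let (γ , (cx , cy) , _) = flag-gon xM zM x≢y in γ , cx , cy
    ...       | no z≢y =
      let (N , xN , M≢N) = other-line x M
          (γ , (cx , _ , cy) , _) = antiflag-gon Q x∉L xM zM zL xN M≢N yL z≢y
      in γ , cx , cy

    point-line : ∀ x L → CommonGon (inj₁ x) (inj₂ L)
    point-line x L with x I? L
    ... | yes xL = let (z , zL , x≢z) = other-point L x
                       (γ , (cx , _) , cL) = flag-gon xL zL x≢z
                   in γ , cx , cL
    ... | no x∉L =
      let (y , M , xM , yM , yL) = project x∉L
          (N , xN , M≢N) = other-line x M
          (z , zL , y≢z) = other-point L y
          (γ , (cx , _) , (_ , cL , _)) = antiflag-gon Q x∉L xM yM yL xN M≢N zL y≢z
      in γ , cx , cL

    -- The quadrangle has `M`, the line from `x` to its projection on `L`, and a freely chosen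
    -- second line on `x` as sides. Either `K` is `M` or `K` can be that second line.
    off-line : ∀ {x K L} → x I K → ¬ x I L → CommonGon (inj₂ K) (inj₂ L)
    off-line {x} {K} {L} xK x∉L with project x∉L
    ... | y , M , xM , yM , yL with other-point L y | M ≟ₗ K
    ...   | z , zL , y≢z | no M≢K =
      let (γ , _ , (_ , cL , cK)) = antiflag-gon Q x∉L xM yM yL xK M≢K zL y≢z in γ , cK , cL
    ...   | z , zL , y≢z | yes refl =
      let (N , xN , M≢N) = other-line x M
          (γ , _ , (cM , cL , _)) = antiflag-gon Q x∉L xM yM yL xN M≢N zL y≢z in γ , cM , cL

    line-line : ∀ K L → CommonGon (inj₂ K) (inj₂ L)
    line-line K L
      with proj₁ (proj₁ order K) zero | Equivalence.from (proj₂ (proj₂ (proj₁ order K)) _) (zero , refl)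
    ... | x | xK with other-point K x
    ...   | y , yK , x≢y with x I? L | y I? L
    ...     | no x∉L | _      = off-line xK x∉L
    ...     | _      | no y∉L = off-line yK y∉L
    ...     | yes xL | yes yL with join x≢y xK yK xL yL
    ...       | refl = let (γ , _ , cL) = flag-gon xL yL x≢y in γ , cL , cL

    common-gon : ∀ a b → CommonGon a b
    common-gon (inj₁ x) (inj₁ y) = point-point x y
    common-gon (inj₁ x) (inj₂ L) = point-line x L
    common-gon (inj₂ L) (inj₁ x) = let (γ , cx , cL) = point-line x L in γ , cL , cx
    common-gon (inj₂ K) (inj₂ L) = line-line K L

    -- A sub triangle may have a vertex on the opposite side. This is decided first: if it happens,
    -- two vertices lie on two sides and `linear` applies; otherwise `noTriangle` does.
    no-smaller-gon : ∀ k → 2 ≤ k → k < 4 → ¬ SubGon k S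
    no-smaller-gon 2 _ _ γ
      with linear (side (inj₁ refl)) (side {# 1} (inj₂ refl)) (side {# 0} {# 1} (inj₂ refl)) (side (inj₁ refl))
      where side = λ {i j} → Morphism.preserves (SubGon.embedding γ) {i} {j}
    ... | inj₁ eq = case SubGon.verticesDistinct γ eq of λ ()
    ... | inj₂ eq = case SubGon.sidesDistinct γ eq of λ ()
    no-smaller-gon 3 _ _ γ with vertex (# 0) I? side (# 1)
      where vertex = Morphism.onPoints (SubGon.embedding γ)
            side = Morphism.onLines (SubGon.embedding γ)
    ... | yes on with linear on (incident (inj₁ refl)) (incident {# 0} {# 0} (inj₁ refl)) (incident (inj₂ refl))
      where incident = λ {i j} → Morphism.preserves (SubGon.embedding γ) {i} {j}
    ...   | inj₁ eq = case SubGon.verticesDistinct γ eq of λ ()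
    ...   | inj₂ eq = case SubGon.sidesDistinct γ eq of λ ()
    no-smaller-gon 3 _ _ γ | no off =
      case SubGon.verticesDistinct γ (proj₁ (noTriangle off
        (incident {# 0} {# 0} (inj₁ refl)) (incident {# 1} (inj₂ refl)) (incident (inj₁ refl))
        (incident {# 0} {# 2} (inj₂ refl)) (incident {# 2} (inj₁ refl)) (incident (inj₂ refl)))) of λ ()
      where incident = λ {i j} → Morphism.preserves (SubGon.embedding γ) {i} {j}
    no-smaller-gon (suc (suc (suc (suc k)))) _ (s≤s (s≤s (s≤s (s≤s ()))))
    no-smaller-gon 1 (s≤s ())

  quadrangle⇒polygon : Element S → IsWeakGeneralizedPolygon 4 S
  quadrangle⇒polygon a = record
    { nonempty = a ; commonGon = common-gon ; noSmallerGon = no-smaller-gon }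

-- Splits of a quadrangle into rows and columns

record FiniteQuadrangle (s t : ℕ) (S : Geometry) : Set where
  field
    quadrangle : Quadrangle S
    finite     : IsFinite S
    order      : HasOrder S s t
    2≤s        : 2 ≤ s
    2≤t        : 2 ≤ t
  open Quadrangle quadrangle public

dualFinite : ∀ {s t S} → FiniteQuadrangle s t S → FiniteQuadrangle t s (dual S)
dualFinite F = record
  { quadrangle = dualQuadrangle quadrangle ; finite = swap finite
  ; order = swap order ; 2≤s = 2≤t ; 2≤t = 2≤s }
  where open FiniteQuadrangle F

-- In effect an epimorphism onto the 2 × 2 grid, written in Boolean coordinates: the point `i j` of
-- the grid lies on the row `i` and the column `j`. Larger grids are first coarsened to this shape.
record Split (S : Geometry) : Set₁ where
  open Geometry S using (_I_)
  field
    Row Col   : Bool → Pred (Line S) 0ℓ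
    Row?      : ∀ i → Decidable (Row i)
    Col?      : ∀ j → Decidable (Col j)
    row col   : Point S → Bool
    kind      : ∀ L → (∃[ i ] Row i L) ⊎ (∃[ j ] Col j L)
    exclusive : ∀ {i j L} → Row i L → ¬ Col j L
    on-row    : ∀ {x L i} → x I L → Row i L → row x ≡ i
    on-col    : ∀ {x L j} → x I L → Col j L → col x ≡ j
    point     : ∀ i j → ∃[ x ] row x ≡ i × col x ≡ j
    rowLine   : ∀ i → ∃ (Row i)
    colLine   : ∀ j → ∃ (Col j)

transpose : ∀ {S} → Split S → Split S
transpose D = record
  { Row = Col ; Col = Row ; Row? = Col? ; Col? = Row? ; row = col ; col = row
  ; kind = Sum.swap ∘ kind ; exclusive = flip exclusive
  ; on-row = on-col ; on-col = on-row
  ; point = λ i j → let (x , p , q) = point j i in x , q , p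
  ; rowLine = colLine ; colLine = rowLine }
  where open Split D

module _ {s t S} (F : FiniteQuadrangle s t S) where
  open FiniteQuadrangle F
  open Geometry S using (_I_; _~_)

  private
    finP = proj₁ finite
    finL = proj₂ finite

  _~?_ : ∀ x y → Dec (x ~ y)
  x ~? y = ∃? finL (λ L → (x I? L) ×-dec (y I? L))

  module Basic (D : Split S) where
    open Split D

    to-col : ∀ {x K j} → col x ≡ j → Col (not j) K → ¬ x I K
    to-col refl Kj xK = Bool.not-¬ refl (on-col xK Kj)

    -- All points of a column line have the same `col`, so a line joining different columns is a row
    -- line.
    line-between : ∀ {x y N} → x I N → y I N → col x ≢ col y → row x ≡ row y × Row (row x) N
    line-between {x} {y} {N} xN yN x≢y with kind N
    ... | inj₁ (i , Ni) = trans (on-row xN Ni) (sym (on-row yN Ni)) , subst (λ i → Row i N) (sym (on-row xN Ni)) Ni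
    ... | inj₂ (j , Nj) = contradiction (trans (on-col xN Nj) (sym (on-col yN Nj))) x≢y

    -- The projecting line joins different columns, so it is a row line and the projection keeps the
    -- row of `x`.
    project-col : ∀ {x j K} → col x ≡ j → Col (not j) K →
                  ∃₂ λ y N → x I N × y I N × y I K × row y ≡ row x × Row (row x) N
    project-col {x} refl Kj with project (to-col refl Kj)
    ... | y , N , xN , yN , yK =
      let (eq , Nx) = line-between xN yN (λ eq → Bool.not-¬ refl (trans eq (on-col yK Kj)))
      in y , N , xN , yN , yK , sym eq , Nx

    row-through : ∀ x → ∃[ N ] x I N × Row (row x) N
    row-through x = let (y , N , xN , _ , _ , _ , Nx) = project-col refl (proj₂ (colLine (not (col x)))) in N , xN , Nx

    #rows #cols : Point S → ℕ
    #rows x = count finL (λ L → (x I? L) ×-dec Row? (row x) L)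
    #cols x = count finL (λ L → (x I? L) ×-dec Col? (col x) L)

    #rows+#cols : ∀ x → #rows x + #cols x ≡ suc t
    #rows+#cols x = begin
      #rows x + #cols x
        ≡⟨ cong (#rows x +_) (count-cong finL (λ L → (x I? L) ×-dec Col? (col x) L)
             (λ L → (x I? L) ×-dec ¬? (Row? (row x) L))
             (λ (xL , Lj) → xL , λ Li → exclusive Li Lj) not-row) ⟩
      #rows x + count finL (λ L → (x I? L) ×-dec ¬? (Row? (row x) L))
        ≡⟨ count-split finL (x I?_) (Row? (row x)) ⟨
      count finL (x I?_)
        ≡⟨ count-hasSize finL _≟ₗ_ (x I?_) (proj₂ order x) ⟩
      suc t ∎
      where
      open ≡-Reasoning
      not-row : ∀ {L} → x I L × ¬ Row (row x) L → x I L × Col (col x) L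
      not-row {L} (xL , ¬Li) with kind L
      ... | inj₁ (i , Li) = contradiction (subst (λ i → Row i L) (sym (on-row xL Li)) Li) ¬Li
      ... | inj₂ (j , Lj) = xL , subst (λ j → Col j L) (sym (on-col xL Lj)) Lj

    width : Line S → Bool → ℕ
    width L j = count finP (λ y → (y I? L) ×-dec (col y Bool.≟ j))

  module _ (D : Split S) where
    open Split D
    open Basic D
    private
      module T where
        open Basic (transpose D) public
        open Split (transpose D) public

    private
      partner : ∀ {i L L′} → Row i L → Row (not i) L′ → ∀ {j} y → y I L × col y ≡ j →
                ∃! _≡_ (λ z → (z I L′ × col z ≡ j) × y ~ z)
      partner Li L′i y (yL , refl) with T.project-col (on-row yL Li) L′i
      ... | z , N , yN , zN , zL′ , eq , _ = z , ((zL′ , eq) , N , yN , zN) ,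
        λ ((wL′ , _) , M , yM , wM) →
          proj₁ (noTriangle (T.to-col (on-row yL Li) L′i) yN zN zL′ yM wM wL′)

    -- Projection from `L` to `L′` runs along column lines. It therefore keeps the column, and
    -- projecting back inverts it.
    width-opposite : ∀ {i L L′} → Row i L → Row (not i) L′ → ∀ j → width L j ≡ width L′ j
    width-opposite {i} {L} {L′} Li L′i j = count-bijection finP finP
      (λ y → (y I? L) ×-dec (col y Bool.≟ j)) (λ y → (y I? L′) ×-dec (col y Bool.≟ j)) _~?_
      (partner Li L′i)
      (λ y yj → let (z , (zj , N , yN , zN) , unique) = partner L′i
                      (subst (λ i → Row i L) (sym (Bool.not-involutive i)) Li) y yj in
        z , (zj , N , zN , yN) , λ (wj , M , wM , yM) → unique (wj , M , yM , wM))

    rowLine-width : ∀ {i L} → Row i L → ∀ j → width L j ≡ width (proj₁ (rowLine false)) j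
    rowLine-width {true}  Li j = width-opposite Li (proj₂ (rowLine false)) j
    -- Two lines of the same class may meet, so they are compared through a line of the other class.
    rowLine-width {false} Li j = trans (width-opposite Li (proj₂ (rowLine true)) j)
                                       (width-opposite (proj₂ (rowLine true)) (proj₂ (rowLine false)) j)

    -- Each row line at x meets exactly one line through y, and that line is a column line.
    #rows≡#cols : ∀ {x y} → row y ≡ not (row x) → col y ≡ not (col x) → #rows x ≡ #cols y
    #rows≡#cols {x} {y} row-y col-y = count-bijection finL finL
      (λ L → (x I? L) ×-dec Row? (row x) L) (λ M → (y I? M) ×-dec Col? (col y) M)
      (λ L M → ∃? finP (λ z → (z I? L) ×-dec (z I? M)))
      (λ L (xL , Lx) →
        let Lx′ = subst (λ i → Row i L) (sym (Bool.not-involutive _)) Lx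
            (z , M , yM , zM , zL , _ , My) = T.project-col row-y Lx′
        in M , ((yM , My) , z , zL , zM) ,
           λ ((yM′ , _) , z′ , z′L , z′M′) →
             proj₂ (noTriangle (T.to-col row-y Lx′) yM zM zL yM′ z′M′ z′L))
      (λ M (yM , My) →
        let My′ = subst (λ j → Col j M) col-y My
            (z , L , xL , zL , zM , _ , Lx) = project-col refl My′
        in L , ((xL , Lx) , z , zL , zM) ,
           λ ((xL′ , _) , z′ , z′L′ , z′M) →
             proj₂ (noTriangle (to-col refl My′) xL zL zM xL′ z′L′ z′M))

  -- Every point off `L` is collinear with exactly one point `y` of `L`, and each `y` lies on `t`
  -- further lines with `s` further points each.
  #points : Line S → count finP every? ≡ suc s + suc s * (t * s)
  #points L = begin
    count finP every?
      ≡⟨ count-split finP every? (_I? L) ⟩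
    count finP (λ x → every? x ×-dec (x I? L)) + count finP (λ x → every? x ×-dec ¬? (x I? L))
      ≡⟨ cong₂ _+_
           (count-cong finP (λ x → every? x ×-dec (x I? L)) (_I? L) proj₂ (refl ,_))
           (count-cong finP (λ x → every? x ×-dec ¬? (x I? L)) (λ x → ¬? (x I? L)) proj₂ (refl ,_)) ⟩
    count finP (_I? L) + count finP (λ x → ¬? (x I? L))
      ≡⟨ cong (count finP (_I? L) +_) (count-fibres finP finP (λ x → ¬? (x I? L)) (_I? L) _~?_
           (λ x x∉L → let (y , M , xM , yM , yL) = project x∉L in
             y , (yL , M , xM , yM) , λ (zL , N , xN , zN) → proj₁ (noTriangle x∉L xM yM yL xN zN zL))
           λ y → neighbours) ⟩
    count finP (_I? L) + count finP (_I? L) * (t * s)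
      ≡⟨ cong (λ k → k + k * (t * s)) (count-hasSize finP _≟ₚ_ (_I? L) (proj₁ order L)) ⟩
    suc s + suc s * (t * s) ∎
    where
    open ≡-Reasoning
    neighbours : ∀ {y} → y I L → count finP (λ x → ¬? (x I? L) ×-dec (x ~? y)) ≡ t * s
    neighbours {y} yL = trans
      (count-fibres finP finL (λ x → ¬? (x I? L) ×-dec (x ~? y)) (λ M → (y I? M) ×-dec ¬? (M ≟ₗ L)) _I?_
        (λ { x (x∉L , M , xM , yM) → M , ((yM , λ { refl → x∉L xM }) , xM) ,
             λ ((yN , _) , xN) → join (λ { refl → x∉L yL }) xM yM xN yN })
        (λ M (yM , M≢L) → trans
          (count-cong finP (λ x → (¬? (x I? L) ×-dec (x ~? y)) ×-dec (x I? M)) (λ x → (x I? M) ×-dec ¬? (x ≟ₚ y))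
            (λ { ((x∉L , _) , xM) → xM , λ { refl → x∉L yL } })
            (λ (xM , x≢y) → ((λ xL → x≢y (meet M≢L xM yM xL yL)) , M , xM , yM) , xM))
          (suc-injective (trans (sym (count-remove finP _≟ₚ_ (_I? M) y yM))
            (count-hasSize finP _≟ₚ_ (_I? M) (proj₁ order M))))))
      (cong (_* s) (suc-injective (trans (sym (count-remove finL _≟ₗ_ (y I?_) L yL))
        (count-hasSize finL _≟ₗ_ (y I?_) (proj₂ order y)))))

  module Counts (D : Split S) where
    open Split D
    open Basic D
    private module T where
      open Basic (transpose D) public

    r : Bool → Bool → ℕ
    r i j = #rows (proj₁ (point i j))

    m n : Bool → ℕ
    m = T.width (proj₁ (colLine false))
    n = width (proj₁ (rowLine false))

    -- Two points of the same cell are compared through a point of the opposite cell.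
    #rows≡r : ∀ x → #rows x ≡ r (row x) (col x)
    #rows≡r x with point (row x) (col x) | point (not (row x)) (not (col x))
    ... | y , row-y , col-y | z , row-z , col-z =
      trans (#rows≡#cols D row-z col-z)
            (sym (#rows≡#cols D (trans row-z (cong not (sym row-y))) (trans col-z (cong not (sym col-y)))))

    #cols≡r : ∀ x → #cols x ≡ r (not (row x)) (not (col x))
    #cols≡r x with point (not (row x)) (not (col x))
    ... | y , row-y , col-y = sym (#rows≡#cols D
      (trans (sym (Bool.not-involutive _)) (cong not (sym row-y)))
      (trans (sym (Bool.not-involutive _)) (cong not (sym col-y))))

    r-balance : ∀ i j → r i j + r (not i) (not j) ≡ suc t
    r-balance i j with point i j | #cols≡r (proj₁ (point i j)) | #rows+#cols (proj₁ (point i j))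
    ... | x , refl , refl | cols | total = trans (cong (#rows x +_) (sym cols)) total

    r-positive : ∀ i j → 1 ≤ r i j
    r-positive i j = let x = proj₁ (point i j) ; (N , xN) = row-through x in
      count-positive finL _≟ₗ_ (λ L → (x I? L) ×-dec Row? (row x) L) N xN

    m-sum : m false + m true ≡ suc s
    m-sum = trans (sym (count-bool finP (_I? proj₁ (colLine false)) row))
                  (count-hasSize finP _≟ₚ_ (_I? proj₁ (colLine false)) (proj₁ order (proj₁ (colLine false))))

    n-sum : n false + n true ≡ suc s
    n-sum = trans (sym (count-bool finP (_I? proj₁ (rowLine false)) col))
                  (count-hasSize finP _≟ₚ_ (_I? proj₁ (rowLine false)) (proj₁ order (proj₁ (rowLine false))))

    point-in-col : ∀ {i L} → Row i L → ∀ j → ∃[ y ] y I L × col y ≡ j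
    point-in-col {i} {L} Li j with point (not i) j
    ... | x , row-x , refl =
      let (y , N , xN , yN , yL , eq , _) = T.project-col row-x (subst (λ i → Row i L) (sym (Bool.not-involutive i)) Li)
      in y , yL , eq

    n-positive : ∀ j → 1 ≤ n j
    n-positive j = let (L , L₀) = rowLine false ; (y , yj) = point-in-col L₀ j in
      count-positive finP _≟ₚ_ (λ y → (y I? L) ×-dec (col y Bool.≟ j)) y yj

    Cell? : ∀ i j → Decidable (λ x → row x ≡ i × col x ≡ j)
    Cell? i j x = (row x Bool.≟ i) ×-dec (col x Bool.≟ j)

    -- A line from `y` into cell `i j` joins different rows, so it is a column line; each column
    -- line at `y` has `m i` points in row `i`, all of them in column `j`.
    cell-neighbours : ∀ {i j y} → row y ≡ not i → col y ≡ j →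
      count finP (λ w → Cell? i j w ×-dec (w ~? y)) ≡ #cols y * m i
    cell-neighbours {i} {j} {y} row-y refl = count-fibres finP finL
      (λ w → Cell? i j w ×-dec (w ~? y)) (λ N → (y I? N) ×-dec Col? (col y) N) _I?_
      (λ { w ((refl , col-w) , N , wN , yN) →
        let w≢y = λ w≡y → Bool.not-¬ refl (trans (cong row w≡y) row-y)
            Nw = proj₂ (T.line-between wN yN λ eq → Bool.not-¬ refl (trans eq row-y))
        in N , ((yN , subst (λ j → Col j N) col-w Nw) , wN) ,
           λ ((yM , _) , wM) → join w≢y wN yN wM yM })
      (λ N (yN , Nj) → trans
        (count-cong finP (λ w → (Cell? i j w ×-dec (w ~? y)) ×-dec (w I? N))
                         (λ w → (w I? N) ×-dec (row w Bool.≟ i))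
          (λ (((row-w , _) , _) , wN) → wN , row-w)
          (λ (wN , row-w) → ((row-w , on-col wN Nj) , N , wN , yN) , wN))
        (rowLine-width (transpose D) Nj i))

    -- The cell is projected onto a row line `L` of class `not i`. The images are the `n j` points
    -- of `L` in column `j`, and over each of them `cell-neighbours` counts the fibre, with
    -- `#cols y` equal to `r i (not j)`.
    cell-size : ∀ i j → count finP (Cell? i j) ≡ n j * (r i (not j) * m i)
    cell-size i j with rowLine (not i)
    ... | L , Li = trans
      (count-fibres finP finP (Cell? i j) (λ y → (y I? L) ×-dec (col y Bool.≟ j)) _~?_
        (λ { w (row-w , refl) →
          let (y , N , wN , yN , yL , eq , _) = T.project-col row-w Li
          in y , ((yL , eq) , N , wN , yN) ,
             λ ((zL , _) , M , wM , zM) → proj₁ (noTriangle (T.to-col row-w Li) wN yN yL wM zM zL) })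
        (λ { y (yL , col-y) → trans (cell-neighbours (on-row yL Li) col-y)
          (cong (_* m i) (trans (#cols≡r y) (cong₂ r
            (trans (cong not (on-row yL Li)) (Bool.not-involutive i)) (cong not col-y)))) }))
      (cong (_* (r i (not j) * m i)) (rowLine-width D Li j))

    #points-by-cells :
      count finP every? ≡
        (n false * (r false true * m false) + n true * (r false false * m false))
      + (n false * (r true true * m true) + n true * (r true false * m true))
    #points-by-cells = trans (count-bool finP every? row) (cong₂ _+_ (by-row false) (by-row true))
      where
      by-row : ∀ i → count finP (λ x → every? x ×-dec (row x Bool.≟ i)) ≡
                     n false * (r i true * m i) + n true * (r i false * m i)
      by-row i = trans (count-bool finP (λ x → every? x ×-dec (row x Bool.≟ i)) col)
        (cong₂ _+_ (trans (forget false) (cell-size i false)) (trans (forget true) (cell-size i true)))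
        where
        forget : ∀ j → count finP (λ x → (every? x ×-dec (row x Bool.≟ i)) ×-dec (col x Bool.≟ j)) ≡
                       count finP (Cell? i j)
        forget j = count-cong finP (λ x → (every? x ×-dec (row x Bool.≟ i)) ×-dec (col x Bool.≟ j)) (Cell? i j)
          (λ ((_ , p) , q) → p , q) (λ (p , q) → (refl , p) , q)

    -- Take `z` on `L` in column `true` and `y` on `M` in column `false`. The projection of `y` onto
    -- a column line at `z` lies in row `i`, hence is `z` itself. So `y` and `z` share a row line,
    -- which is the only one at either point and equals both `L` and `M`.
    row-unique : ∀ i → (∀ {K} → Col true K → T.width K i ≡ 1) → (∀ x → row x ≡ i → #rows x ≡ 1) →
                 ∀ {L M} → Row i L → Row i M → L ≡ M
    row-unique i thin one {L} {M} Li Mi with point-in-col Li true | point-in-col Mi false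
    ... | z , zL , col-z | y , yM , col-y
      with T.row-through z
    ...   | K , zK , Kz with subst (λ j → Col j K) col-z Kz
    ...     | K₁ with project-col col-y K₁
    ...       | w , N , yN , wN , wK , row-w , Ny
      with count≡1⇒unique finP _≟ₚ_ (λ x → (x I? K) ×-dec (row x Bool.≟ i)) (thin K₁) w z
             (wK , trans row-w (on-row yM Mi)) (zK , on-row zL Li)
    ...         | refl = trans
      (count≡1⇒unique finL _≟ₗ_ (λ L → (z I? L) ×-dec Row? (row z) L) (one z (on-row zL Li)) L N
        (zL , subst (λ i → Row i L) (sym (on-row zL Li)) Li)
        (wN , subst (λ i → Row i N) (sym row-w) Ny))
      (count≡1⇒unique finL _≟ₗ_ (λ L → (y I? L) ×-dec Row? (row y) L) (one y (on-row yM Mi)) N M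
        (yN , Ny) (yM , subst (λ i → Row i M) (sym (on-row yM Mi)) Mi))

  -- Singleton classes and cells

  module _ (D : Split S) where
    open Split D
    open Basic D
    open Counts D
    private
      module T = Counts (transpose D)

      suc∘pred : ∀ {k} → 1 ≤ k → suc (pred k) ≡ k
      suc∘pred (s≤s _) = refl

      μ ν : Bool → ℕ
      μ = pred ∘ m
      ν = pred ∘ n
      a : Bool → Bool → ℕ
      a i j = pred (r i j)

      m≡ : ∀ i → suc (μ i) ≡ m i
      m≡ i = suc∘pred (T.n-positive i)
      n≡ : ∀ j → suc (ν j) ≡ n j
      n≡ j = suc∘pred (n-positive j)
      r≡ : ∀ i j → suc (a i j) ≡ r i j
      r≡ i j = suc∘pred (r-positive i j)

      pred-sum : ∀ {p q k} → 1 ≤ p → 1 ≤ q → p + q ≡ suc k → pred p + pred q ≡ pred k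
      pred-sum {suc p} {suc q} _ _ eq = cong pred (suc-injective (trans (cong suc (sym (+-suc p q))) eq))

      μ-sum : μ false + μ true ≡ pred s
      μ-sum = pred-sum (T.n-positive false) (T.n-positive true) m-sum
      ν-sum : ν false + ν true ≡ pred s
      ν-sum = pred-sum (n-positive false) (n-positive true) n-sum
      a-sum : ∀ i j → a i j + a (not i) (not j) ≡ pred t
      a-sum i j = pred-sum (r-positive i j) (r-positive (not i) (not j)) (r-balance i j)

      total : suc (suc (pred s)) + suc (suc (pred s)) * (suc (pred t) * suc (pred s)) ≡ CellTotal μ ν a
      total = begin
        suc (suc (pred s)) + suc (suc (pred s)) * (suc (pred t) * suc (pred s))
          ≡⟨ cong₂ (λ x y → suc x + suc x * (y * x)) (suc∘pred (<⇒≤ 2≤s)) (suc∘pred (<⇒≤ 2≤t)) ⟩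
        suc s + suc s * (t * s)
          ≡⟨ #points (proj₁ (rowLine false)) ⟨
        count finP every?
          ≡⟨ #points-by-cells ⟩
        _ ≡⟨ cong₂ _+_ (cong₂ _+_ (cell false false) (cell false true))
                       (cong₂ _+_ (cell true false) (cell true true)) ⟨
        CellTotal μ ν a ∎
        where
        open ≡-Reasoning
        cell : ∀ i j → suc (ν j) * (suc (a i (not j)) * suc (μ i)) ≡ n j * (r i (not j) * m i)
        cell i j = cong₂ _*_ (n≡ j) (cong₂ _*_ (r≡ i (not j)) (m≡ i))

      one : ∀ {x y} → suc x ≡ y → x ≡ 0 → y ≡ 1
      one eq refl = sym eq

      not-both-zero : ∀ {k} → 2 ≤ k → ∀ {p q} → p + q ≡ pred k → p ≡ 0 → q ≢ 0
      not-both-zero (s≤s (s≤s _)) {zero} {zero} () _ _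

      apart : ∀ {f : Bool → ℕ} {k} → 2 ≤ k → f false + f true ≡ pred k → ∀ i → f i ≡ 0 → f (not i) ≢ 0
      apart 2≤k eq false = not-both-zero 2≤k eq
      apart {f} 2≤k eq true = not-both-zero 2≤k (trans (+-comm (f true) (f false)) eq)

    Thin : Set
    Thin = (∃[ i ] m i ≡ 1 × (∀ j → r i j ≡ 1))
         ⊎ (∃[ j ] n j ≡ 1 × (∀ i → r (not i) (not j) ≡ 1))
         ⊎ (∃₂ λ i j → m i ≡ 1 × n j ≡ 1 × r i (not j) ≡ 1)

    private
      balanced : Excess μ ν a ≡ 0
      balanced = excess-vanishes μ ν a μ-sum ν-sum (a-sum false false) (a-sum false true) total

      vanishing : Outcome μ ν a
      vanishing = outcome μ ν a (Excess-vanishing μ ν a balanced)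
        (apart 2≤s μ-sum) (apart 2≤s ν-sum) (λ i j → not-both-zero 2≤t (a-sum i j))

    thin : Thin
    thin = Sum.map
      (λ (i , μ≡0 , a≡0) → i , one (m≡ i) μ≡0 , λ j → one (r≡ i j) (a≡0 j))
      (Sum.map
        (λ (j , ν≡0 , a≡0) → j , one (n≡ j) ν≡0 , λ i → one (r≡ (not i) (not j)) (a≡0 i))
        (λ (i , j , μ≡0 , ν≡0 , a≡0) → i , j , one (m≡ i) μ≡0 , one (n≡ j) ν≡0 , one (r≡ i (not j)) a≡0))
      vanishing

    -- Common to all three cases of `Thin`; this is what large grids contradict.
    r-somewhere-1 : ∃₂ λ i j → r i j ≡ 1
    r-somewhere-1 = somewhere thin
      where
      somewhere : Thin → ∃₂ λ i j → r i j ≡ 1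
      somewhere (inj₁ (i , _ , r≡1))                = i , false , r≡1 false
      somewhere (inj₂ (inj₁ (j , _ , r≡1)))         = true , not j , r≡1 false
      somewhere (inj₂ (inj₂ (i , j , _ , _ , r≡1))) = i , not j , r≡1

    SingletonClass : Set
    SingletonClass = (∃[ i ] (∀ {L M} → Row i L → Row i M → L ≡ M))
                   ⊎ (∃[ j ] (∀ {L M} → Col j L → Col j M → L ≡ M))
                   ⊎ (∃₂ λ i j → ∀ {x y} → row x ≡ i × col x ≡ j → row y ≡ i × col y ≡ j → x ≡ y)

    singleton-class : SingletonClass
    singleton-class = Sum.map
      (λ (i , m≡1 , r≡1) → i , row-unique i
        (λ K₁ → trans (rowLine-width (transpose D) K₁ i) m≡1)
        (λ { x refl → trans (#rows≡r x) (r≡1 (col x)) }))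
      (Sum.map
        (λ (j , n≡1 , r≡1) → j , T.row-unique j
          (λ L₁ → trans (rowLine-width D L₁ j) n≡1)
          (λ { x refl → trans (#cols≡r x) (r≡1 (row x)) }))
        (λ (i , j , m≡1 , n≡1 , r≡1) → i , j , λ {x} {y} →
          count≡1⇒unique finP _≟ₚ_ (Cell? i j)
            (trans (cell-size i j) (cong₂ _*_ n≡1 (cong₂ _*_ r≡1 m≡1))) x y))
      thin

-- The split of a grid at a point

preimage : {X Y : Set} {f : X → Y} → Surjective _≡_ _≡_ f → ∀ y → ∃[ x ] f x ≡ y
preimage surj y = let (x , fx≡) = surj y in x , fx≡ refl

size-2 : {X : Set} {P : Pred X 0ℓ} → HasSize P 2 → ∀ {x y z} → P x → P y → P z → x ≢ y → z ≡ x ⊎ z ≡ y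
size-2 (f , _ , P⇔f) Px Py Pz x≢y
  with Equivalence.to (P⇔f _) Px | Equivalence.to (P⇔f _) Py | Equivalence.to (P⇔f _) Pz
... | i , refl | j , refl | k , refl = Sum.map (cong f) (cong f) (among i j k (x≢y ∘ cong f))
  where
  among : (i j k : Fin 2) → i ≢ j → k ≡ i ⊎ k ≡ j
  among zero       zero       _          i≢j = contradiction refl i≢j
  among (suc zero) (suc zero) _          i≢j = contradiction refl i≢j
  among zero       _          zero       _   = inj₁ refl
  among _          zero       zero       _   = inj₂ refl
  among (suc zero) _          (suc zero) _   = inj₁ refl
  among _          (suc zero) (suc zero) _   = inj₂ refl

size-third : {X : Set} {P : Pred X 0ℓ} → ∀ {k} → HasSize P (3 + k) → ∀ {x y} → P x → P y →
             ∃[ z ] P z × z ≢ x × z ≢ y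
size-third {k = k} (f , f-inj , P⇔f) Px Py
  with Equivalence.to (P⇔f _) Px | Equivalence.to (P⇔f _) Py
... | i , refl | j , refl =
  let (l , l≢i , l≢j) = third i j
  in f l , Equivalence.from (P⇔f _) (l , refl) , l≢i ∘ f-inj , l≢j ∘ f-inj
  where
  third : (i j : Fin (3 + k)) → ∃[ l ] l ≢ i × l ≢ j
  third zero          zero          = # 1 , (λ ()) , λ ()
  third zero          (suc zero)    = # 2 , (λ ()) , λ ()
  third zero          (suc (suc _)) = # 1 , (λ ()) , λ ()
  third (suc zero)    zero          = # 2 , (λ ()) , λ ()
  third (suc (suc _)) zero          = # 1 , (λ ()) , λ ()
  third (suc _)       (suc _)       = # 0 , (λ ()) , λ ()

pullback : ∀ {S G} (Φ : Morphism S G) → IsEpimorphism Φ → Split G → Split S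
pullback Φ (surjP , surjL) D = record
  { Row = λ i → Row i ∘ onLines Φ ; Col = λ j → Col j ∘ onLines Φ
  ; Row? = λ i → Row? i ∘ onLines Φ ; Col? = λ j → Col? j ∘ onLines Φ
  ; row = row ∘ onPoints Φ ; col = col ∘ onPoints Φ
  ; kind = kind ∘ onLines Φ
  ; exclusive = exclusive
  ; on-row = on-row ∘ preserves Φ
  ; on-col = on-col ∘ preserves Φ
  ; point = λ i j → let (x , p) = point i j ; (y , eq) = preimage surjP x
                    in y , subst (λ x → row x ≡ i × col x ≡ j) (sym eq) p
  ; rowLine = λ i → let (L , p) = rowLine i ; (M , eq) = preimage surjL L in M , subst (Row i) (sym eq) p
  ; colLine = λ j → let (L , p) = colLine j ; (M , eq) = preimage surjL L in M , subst (Col j) (sym eq) p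
  }
  where open Split D

module _ {G : Geometry} (Q : Quadrangle G) {k} (order : HasOrder G (suc k) 1) where
  open Quadrangle Q
  open Geometry G using (_I_)

  record Corner (v : Point G) (H V : Line G) : Set where
    field
      vH   : v I H
      vV   : v I V
      H≢V  : H ≢ V
      only : ∀ {K} → v I K → K ≡ H ⊎ K ≡ V

  corner : ∀ {v H} → v I H → ∃ (Corner v H)
  corner {v} {H} vH = let (V , vV , H≢V) = other-line Q order v H in
    V , record { vH = vH ; vV = vV ; H≢V = H≢V ; only = λ vK → size-2 (proj₂ order v) vH vV vK H≢V }

  flipCorner : ∀ {v H V} → Corner v H V → Corner v V H
  flipCorner c = record { vH = vV ; vV = vH ; H≢V = H≢V ∘ sym ; only = Sum.swap ∘ only }
    where open Corner c

  -- In a grid this is the parallel class of `H`, divided into `H` itself and the lines that meet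
  -- `V` away from `v`.
  Across : Point G → Line G → Line G → Bool → Pred (Line G) 0ℓ
  Across v H V false K = K ≡ H
  Across v H V true  K = ¬ v I K × ∃[ u ] u I V × u I K

  coordinate : Line G → Point G → Bool
  coordinate H x = not (does (x I? H))

  coordinate-on : ∀ {H x} → x I H → coordinate H x ≡ false
  coordinate-on {H} {x} xH with x I? H
  ... | yes _  = refl
  ... | no x∉H = contradiction xH x∉H

  coordinate-off : ∀ {H x} → ¬ x I H → coordinate H x ≡ true
  coordinate-off {H} {x} x∉H with x I? H
  ... | yes xH = contradiction xH x∉H
  ... | no _   = refl

  module _ {v H V} (c : Corner v H V) where
    open Corner c

    -- A line off `v` that met both `H` and `V` would close a triangle at `v`.
    misses-one : ∀ {K u w} → ¬ v I K → u I H → u I K → w I V → w I K → ⊥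
    misses-one v∉K uH uK wV wK = H≢V (proj₂ (noTriangle v∉K vH uH uK vV wV wK))

    -- The projection of `v` onto `K` lies on `H` or on `V`, and by `misses-one` this settles the
    -- class of `K`.
    across? : ∀ i → Decidable (Across v H V i)
    across? false K = K ≟ₗ H
    across? true  K with v I? K
    ... | yes vK = no λ (v∉K , _) → v∉K vK
    ... | no v∉K with project v∉K
    ...   | u , M , vM , uM , uK with only vM
    ...     | inj₁ refl = no λ (_ , w , wV , wK) → misses-one v∉K uM uK wV wK
    ...     | inj₂ refl = yes (v∉K , u , uM , uK)

    across-coordinate : ∀ {i x K} → x I K → Across v H V i K → coordinate H x ≡ i
    across-coordinate {false} xK refl             = coordinate-on xK
    across-coordinate {true}  xK (v∉K , u , uV , uK) = coordinate-off λ xH → misses-one v∉K xH xK uV uK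

    across-exists : ∀ i → ∃ (Across v H V i)
    across-exists false = H , refl
    across-exists true  =
      let (u , uV , v≢u) = other-point Q order V v
          (K , uK , V≢K) = other-line Q order u V
      in K , (λ vK → V≢K (join v≢u vV uV vK uK)) , u , uV , uK

  module _ {v H V} (c : Corner v H V) where
    open Corner c

    cornerSplit : Split G
    cornerSplit = record
      { Row = Across v H V ; Col = Across v V H
      ; Row? = across? c ; Col? = across? (flipCorner c)
      ; row = coordinate H ; col = coordinate V
      ; kind = kind
      ; exclusive = exclusive
      ; on-row = across-coordinate c ; on-col = across-coordinate (flipCorner c)
      ; point = point
      ; rowLine = across-exists c ; colLine = across-exists (flipCorner c)
      }
      where
      kind : ∀ K → (∃[ i ] Across v H V i K) ⊎ (∃[ j ] Across v V H j K)
      kind K with v I? K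
      ... | yes vK = Sum.map (false ,_) (false ,_) (only vK)
      ... | no v∉K with project v∉K
      ...   | u , M , vM , uM , uK with only vM
      ...     | inj₁ refl = inj₂ (true , v∉K , u , uM , uK)
      ...     | inj₂ refl = inj₁ (true , v∉K , u , uM , uK)

      exclusive : ∀ {i j K} → Across v H V i K → ¬ Across v V H j K
      exclusive {false} {false} K≡H K≡V = H≢V (trans (sym K≡H) K≡V)
      exclusive {false} {true}  refl (v∉H , _) = v∉H vH
      exclusive {true}  {false} (v∉V , _) refl = v∉V vV
      exclusive {true}  {true}  (v∉K , w , wV , wK) (_ , u , uH , uK) = misses-one c v∉K uH uK wV wK

      off : ∀ {v H V} → Corner v H V → ∃[ x ] x I H × coordinate V x ≡ true
      off {v} {H} {V} c = let (x , xH , v≢x) = other-point Q order H v in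
        x , xH , coordinate-off λ xV → v≢x (meet (Corner.H≢V c) (Corner.vH c) xH (Corner.vV c) xV)

      point : ∀ i j → ∃[ x ] coordinate H x ≡ i × coordinate V x ≡ j
      point false false = v , coordinate-on vH , coordinate-on vV
      point false true  = let (x , xH , eq) = off c in x , coordinate-on xH , eq
      point true  false = let (x , xV , eq) = off (flipCorner c) in x , eq , coordinate-on xV
      -- The line `K` meets `V` in `u` away from `v`, so it misses `H`; its points other than `u`
      -- are also off `V`.
      point true  true  =
        let (u , uV , v≢u) = other-point Q order V v
            (K , uK , V≢K) = other-line Q order u V
            (x , xK , u≢x) = other-point Q order K u
        in x , across-coordinate c {true} xK ((λ vK → V≢K (join v≢u vV uV vK uK)) , u , uV , uK) ,
           coordinate-off λ xV → u≢x (meet V≢K uV xV uK xK)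

-- Excluding grids with s' at least 2

module _ {s t S G} (F : FiniteQuadrangle s t S) (QG : Quadrangle G) {k} (orderG : HasOrder G (suc k) 1)
         (Φ : Morphism S G) (epi : IsEpimorphism Φ) where
  open FiniteQuadrangle F using (_I?_; finite)
  open Geometry S using (_I_)
  open Geometry G using () renaming (_I_ to _IG_)
  open Quadrangle QG using () renaming (_≟ₗ_ to _≟G_)

  private
    split : ∀ {v H V} → Corner QG orderG v H V → Split S
    split c = pullback Φ epi (cornerSplit QG orderG c)

  #over : Point S → Line G → ℕ
  #over x K = count (proj₂ finite) (λ L → (x I? L) ×-dec (onLines Φ L ≟G K))

  module _ {v H V} (c : Corner QG orderG v H V) where
    open Corner c

    -- The row class `false` consists of `H` alone, so at a point over `H` the row lines are the
    -- lines over `H`.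
    #rows≡#over : ∀ {x} → onPoints Φ x IG H → Basic.#rows F (split c) x ≡ #over x H
    #rows≡#over {x} xH rewrite coordinate-on QG orderG {H} {onPoints Φ x} xH = refl

    #cols≡#over : ∀ {x} → onPoints Φ x IG V → Basic.#cols F (split c) x ≡ #over x V
    #cols≡#over {x} xV rewrite coordinate-on QG orderG {V} {onPoints Φ x} xV = refl

    -- Off the corner, the two arms belong to opposite cells, so `#rows≡#cols` compares them.
    #over-arms : ∀ {x y} → onPoints Φ x IG H → onPoints Φ x ≢ v → onPoints Φ y IG V → onPoints Φ y ≢ v →
                 #over x H ≡ #over y V
    #over-arms {x} {y} xH x≢v yV y≢v = begin
      #over x H                    ≡⟨ #rows≡#over xH ⟨
      Basic.#rows F (split c) x    ≡⟨ #rows≡#cols F (split c)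
        (trans (coordinate-off QG orderG (λ yH → y≢v (meet QG H≢V yH vH yV vV)))
               (cong not (sym (coordinate-on QG orderG xH))))
        (trans (coordinate-on QG orderG yV)
               (cong not (sym (coordinate-off QG orderG (λ xV → x≢v (meet QG H≢V xH vH xV vV)))))) ⟩
      Basic.#cols F (split c) y    ≡⟨ #cols≡#over yV ⟩
      #over y V                    ∎
      where
      open ≡-Reasoning
      open Quadrangle using (meet)

module _ {s t S G} (F : FiniteQuadrangle s t S) (QG : Quadrangle G) {k} (orderG : HasOrder G (2 + k) 1)
         (Φ : Morphism S G) (epi : IsEpimorphism Φ) where
  open FiniteQuadrangle F using (2≤t)
  open Geometry S using (_I_)
  open Geometry G using () renaming (_I_ to _IG_)
  open Quadrangle QG using () renaming (_I?_ to _IG?_)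

  private
    over = #over F QG orderG Φ epi

    -- This needs a third point `z` on `H`, hence at least three points on a line of the grid. In
    -- the corner at `z`, both counts equal the count at one point `q` over the other arm.
    #over-along : ∀ {H x y} → onPoints Φ x IG H → onPoints Φ y IG H → over x H ≡ over y H
    #over-along {H} xH yH =
      let (z , zH , z≢x , z≢y) = size-third (proj₁ orderG H) xH yH
          (V , c) = corner QG orderG zH
          (w , wV , z≢w) = other-point QG orderG V z
          (q , Φq≡w) = preimage (proj₁ epi) w
          arm = λ {p} pH z≢p → #over-arms F QG orderG Φ epi c {p} {q} pH (z≢p ∘ sym)
                  (subst (_IG V) (sym Φq≡w) wV) λ Φq≡z → z≢w (trans (sym Φq≡z) Φq≡w)
      in trans (arm xH z≢x) (sym (arm yH z≢y))

  -- All `r i j` equal `ρ`, and the rows and columns at `p` give `ρ + ρ ≡ suc t`. Since some `r i j`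
  -- is 1, it follows that `t ≡ 1`, against `2 ≤ t`.
  no-large-grid : ∀ {v H} → v IG H → ⊥
  no-large-grid {v} {H} vH = let (i , j , r≡1) = r-somewhere-1 F D in
    contradiction (sym (suc-injective (trans (sym (cong (λ ρ → ρ + ρ) (trans (sym (r≡ρ i j)) r≡1))) ρ+ρ)))
                  (>⇒≢ 2≤t)
    where
    V = proj₁ (corner QG orderG vH)
    c = proj₂ (corner QG orderG vH)
    open Corner c using (vV; H≢V)
    D : Split S
    D = pullback Φ epi (cornerSplit QG orderG c)
    open Basic F D
    open Counts F D
    open Split D

    on-arm : ∀ {H x} → coordinate QG orderG H x ≡ false → x IG H
    on-arm {H} {x} eq with x IG? H
    ... | yes xH = xH
    ... | no _ = case eq of λ ()

    p = proj₁ (point false false)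
    q = proj₁ (point false true)
    pH : onPoints Φ p IG H
    pH = on-arm (proj₁ (proj₂ (point false false)))
    pV : onPoints Φ p IG V
    pV = on-arm (proj₂ (proj₂ (point false false)))
    qH : onPoints Φ q IG H
    qH = on-arm (proj₁ (proj₂ (point false true)))

    ρ : ℕ
    ρ = over p H

    r₀₀ : r false false ≡ ρ
    r₀₀ = #rows≡#over F QG orderG Φ epi c pH

    r₀₁ : r false true ≡ ρ
    r₀₁ = trans (#rows≡#over F QG orderG Φ epi c qH) (#over-along qH pH)

    -- The count is moved from `p` along `V` to `y`, across the corner to `x` over `H`, and along
    -- `H` back to `p`.
    cols≡ρ : #cols p ≡ ρ
    cols≡ρ =
      let (u , uV , v≢u) = other-point QG orderG V v
          (y , Φy≡u) = preimage (proj₁ epi) u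
          yV = subst (_IG V) (sym Φy≡u) uV
          (w , wH , v≢w) = other-point QG orderG H v
          (x , Φx≡w) = preimage (proj₁ epi) w
          xH = subst (_IG H) (sym Φx≡w) wH
      in trans (#cols≡#over F QG orderG Φ epi c pV) (trans (#over-along pV yV)
           (trans (sym (#over-arms F QG orderG Φ epi c xH (λ Φx≡v → v≢w (trans (sym Φx≡v) Φx≡w))
                                                    yV (λ Φy≡v → v≢u (trans (sym Φy≡v) Φy≡u))))
             (#over-along xH pH)))

    ρ+ρ : ρ + ρ ≡ suc t
    ρ+ρ = trans (sym (cong₂ _+_ r₀₀ cols≡ρ)) (#rows+#cols p)

    r≡ρ : ∀ i j → r i j ≡ ρ
    r≡ρ false false = r₀₀
    r≡ρ false true  = r₀₁
    r≡ρ true  true  = +-cancelˡ-≡ ρ _ _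
      (trans (trans (cong (_+ r true true) (sym r₀₀)) (r-balance false false)) (sym ρ+ρ))
    r≡ρ true  false = +-cancelˡ-≡ ρ _ _
      (trans (trans (cong (_+ r true false) (sym r₀₁)) (r-balance false true)) (sym ρ+ρ))

-- Epimorphisms onto an ordinary quadrangle

enumerate-filter : {X : Set} {Q : Pred X 0ℓ} → Decidable Q → ∀ {n} (f : Fin n → X) → Injective _≡_ _≡_ f →
                   ∃ (HasSize (λ x → Q x × ∃[ i ] f i ≡ x))
enumerate-filter Q? {zero} f f-inj = 0 , (λ ()) , (λ { {()} }) , λ x → mk⇔ (λ { (_ , () , _) }) λ ()
enumerate-filter Q? {suc n} f f-inj
  with enumerate-filter Q? (f ∘ suc) (Fin.suc-injective ∘ f-inj) | Q? (f zero)
... | k , g , g-inj , Q⇔g | no ¬Q = k , g , g-inj , λ x → mk⇔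
  (λ { (Qx , zero , refl)  → contradiction Qx ¬Q
     ; (Qx , suc i , fi≡x) → Equivalence.to (Q⇔g x) (Qx , i , fi≡x) })
  (λ gx → let (Qx , i , fi≡x) = Equivalence.from (Q⇔g x) gx in Qx , suc i , fi≡x)
... | k , g , g-inj , Q⇔g | yes Q₀ = suc k , h , h-inj , λ x → mk⇔
  (λ { (Qx , zero , f0≡x)  → zero , f0≡x
     ; (Qx , suc i , fi≡x) → let (j , gj≡x) = Equivalence.to (Q⇔g x) (Qx , i , fi≡x) in suc j , gj≡x })
  (λ { (zero , refl)     → Q₀ , zero , refl
     ; (suc i , gi≡x) → let (Qx , j , fj≡x) = Equivalence.from (Q⇔g x) (i , gi≡x) in Qx , suc j , fj≡x })
  where
  h : Fin (suc k) → _
  h zero    = f zero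
  h (suc i) = g i
  f0≢g : ∀ i → f zero ≢ g i
  f0≢g i f0≡gi with Equivalence.from (Q⇔g (g i)) (i , refl)
  ... | _ , j , fj≡gi = case f-inj (trans f0≡gi (sym fj≡gi)) of λ ()
  h-inj : Injective _≡_ _≡_ h
  h-inj {zero}  {zero}  _  = refl
  h-inj {zero}  {suc j} eq = contradiction eq (f0≢g j)
  h-inj {suc i} {zero}  eq = contradiction (sym eq) (f0≢g i)
  h-inj {suc i} {suc j} eq = cong suc (g-inj eq)

-- For the upper bound, the element of `P` outside `Q` is put in front of the list of `Q`, which
-- gives `suc k` distinct elements of `P`. With `P` the points of a line this yields sizes between 1
-- and `s`.
proper-part : {X : Set} {P Q : Pred X 0ℓ} → ∀ {n} → HasSize P (suc n) → Decidable Q → (∀ {x} → Q x → P x) →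
              ∀ {x y} → Q x → P y → ¬ Q y → ∃[ k ] HasSize Q k × 1 ≤ k × k ≤ n
proper-part {P = P} {Q} {n} (f , f-inj , P⇔f) Q? Q⊆P Qx Py ¬Qy with enumerate-filter Q? f f-inj
... | k , g , g-inj , Q⇔g = k , (g , g-inj , Q⇔) , positive , s≤s⁻¹ (Fin.injective⇒≤ index-inj)
  where
  Q⇔ : ∀ z → Q z ⇔ (∃[ i ] g i ≡ z)
  Q⇔ z = mk⇔ (λ Qz → Equivalence.to (Q⇔g z) (Qz , Equivalence.to (P⇔f z) (Q⊆P Qz)))
             (λ gz → proj₁ (Equivalence.from (Q⇔g z) gz))
  positive : 1 ≤ k
  positive = ≤-trans (s≤s z≤n) (Fin.toℕ<n (proj₁ (Equivalence.to (Q⇔ _) Qx)))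
  element : Fin (suc k) → ∃ P
  element zero    = _ , Py
  element (suc i) = g i , Q⊆P (Equivalence.from (Q⇔ _) (i , refl))
  index : Fin (suc k) → Fin (suc n)
  index i = proj₁ (Equivalence.to (P⇔f _) (proj₂ (element i)))
  element-inj : ∀ i j → proj₁ (element i) ≡ proj₁ (element j) → i ≡ j
  element-inj zero    zero    _  = refl
  element-inj zero    (suc j) eq = contradiction (Equivalence.from (Q⇔ _) (j , sym eq)) ¬Qy
  element-inj (suc i) zero    eq = contradiction (Equivalence.from (Q⇔ _) (i , eq)) ¬Qy
  element-inj (suc i) (suc j) eq = cong suc (g-inj eq)
  index-inj : Injective _≡_ _≡_ index
  index-inj {i} {j} eq = element-inj i j (trans
    (sym (proj₂ (Equivalence.to (P⇔f _) (proj₂ (element i)))))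
    (trans (cong f eq) (proj₂ (Equivalence.to (P⇔f _) (proj₂ (element j))))))

record Square (G : Geometry) : Set where
  open Geometry G using (_I_)
  field
    a b c d     : Point G
    ab bc cd ad : Line G
    a≢b : a ≢ b
    a≢d : a ≢ d
    b≢c : b ≢ c
    ab≢ad : ab ≢ ad
    ab≢bc : ab ≢ bc
    a∈ab : a I ab
    b∈ab : b I ab
    b∈bc : b I bc
    c∈bc : c I bc
    c∈cd : c I cd
    d∈cd : d I cd
    a∈ad : a I ad
    d∈ad : d I ad
    on-ab : ∀ {x} → x I ab → x ≡ a ⊎ x ≡ b
    on-bc : ∀ {x} → x I bc → x ≡ b ⊎ x ≡ c
    on-ad : ∀ {x} → x I ad → x ≡ a ⊎ x ≡ d
    on-cd : ∀ {x} → x I cd → x ≡ c ⊎ x ≡ d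
    through-a : ∀ {M} → a I M → M ≡ ab ⊎ M ≡ ad
    through-b : ∀ {M} → b I M → M ≡ ab ⊎ M ≡ bc

-- The reflection that exchanges `a` with `b` and `c` with `d` turns facts about the fibres of `a`
-- and `d` into facts about those of `b` and `c`.
mirror : ∀ {G} → Square G → Square G
mirror Q = record
  { a = b ; b = a ; c = d ; d = c ; ab = ab ; bc = ad ; cd = cd ; ad = bc
  ; a≢b = a≢b ∘ sym ; a≢d = b≢c ; b≢c = a≢d ; ab≢ad = ab≢bc ; ab≢bc = ab≢ad
  ; a∈ab = b∈ab ; b∈ab = a∈ab ; b∈bc = a∈ad ; c∈bc = d∈ad
  ; c∈cd = d∈cd ; d∈cd = c∈cd ; a∈ad = b∈bc ; d∈ad = c∈bc
  ; on-ab = Sum.swap ∘ on-ab ; on-bc = on-ad ; on-ad = on-bc ; on-cd = Sum.swap ∘ on-cd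
  ; through-a = through-b ; through-b = through-a }
  where open Square Q

module _ {G} (QG : Quadrangle G) (order : HasOrder G 1 1) where
  open Quadrangle QG
  open Geometry G using (_I_)

  -- From the two points of `K` the other lines `ad` and `bc` are drawn, with their other points `d`
  -- and `c`. The line `cd` comes from projecting `d` onto `bc`; it cannot arrive at `b`, for that
  -- would give a triangle on `a`, `b` and `d`.
  squareOn : ∀ K → Σ[ Q ∈ Square G ] Square.ab Q ≡ K
  squareOn K with proj₁ order K
  ... | f , f-inj , K⇔f with Equivalence.from (K⇔f _) (# 0 , refl) | Equivalence.from (K⇔f _) (# 1 , refl)
  ...   | aK | bK with corner QG order aK | corner QG order bK
  ...     | ad , at-a | bc , at-b with other-point QG order ad (f (# 0)) | other-point QG order bc (f (# 1))
  ...       | d , d∈ad , a≢d | c , c∈bc , b≢c with project d∉bc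
    where
    d∉bc : ¬ d I bc
    d∉bc d∈bc = case f-inj (proj₁ (noTriangle d∉ab d∈ad (Corner.vV at-a) aK d∈bc (Corner.vV at-b) bK)) of λ ()
      where
      d∉ab : ¬ d I K
      d∉ab dK = a≢d (meet (Corner.H≢V at-a) aK dK (Corner.vV at-a) d∈ad)
  ...         | y , cd , d∈cd , y∈cd , y∈bc = record
    { a = f (# 0) ; b = f (# 1) ; c = c ; d = d ; ab = K ; bc = bc ; cd = cd ; ad = ad
    ; a≢b = a≢b ; a≢d = a≢d ; b≢c = b≢c ; ab≢ad = Corner.H≢V at-a ; ab≢bc = Corner.H≢V at-b
    ; a∈ab = aK ; b∈ab = bK ; b∈bc = Corner.vV at-b ; c∈bc = c∈bc ; c∈cd = c∈cd ; d∈cd = d∈cd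
    ; a∈ad = Corner.vV at-a ; d∈ad = d∈ad
    ; on-ab = λ xK → size-2 (proj₁ order K) aK bK xK a≢b
    ; on-bc = on-bc
    ; on-ad = λ x → size-2 (proj₁ order ad) (Corner.vV at-a) d∈ad x a≢d
    ; on-cd = λ x → size-2 (proj₁ order cd) c∈cd d∈cd x c≢d
    ; through-a = Corner.only at-a ; through-b = Corner.only at-b
    } , refl
    where
    a≢b : f (# 0) ≢ f (# 1)
    a≢b eq = case f-inj eq of λ ()
    d∉ab : ¬ d I K
    d∉ab dK = a≢d (meet (Corner.H≢V at-a) aK dK (Corner.vV at-a) d∈ad)
    on-bc : ∀ {x} → x I bc → x ≡ f (# 1) ⊎ x ≡ c
    on-bc x = size-2 (proj₁ order bc) (Corner.vV at-b) c∈bc x b≢c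
    c∈cd : c I cd
    c∈cd with on-bc y∈bc
    ... | inj₁ refl = contradiction (proj₁ (noTriangle d∉ab d∈ad (Corner.vV at-a) aK d∈cd y∈cd bK)) a≢b
    ... | inj₂ refl = y∈cd
    c≢d : c ≢ d
    c≢d refl = a≢b (proj₁ (noTriangle d∉ab d∈ad (Corner.vV at-a) aK c∈bc (Corner.vV at-b) bK))

  module Incidences (Q : Square G) where
    open Square Q
    d∉ab : ¬ d I ab
    d∉ab d∈ab = a≢d (meet ab≢ad a∈ab d∈ab a∈ad d∈ad)
    b∉ad : ¬ b I ad
    b∉ad b∈ad = a≢b (meet ab≢ad a∈ab b∈ab a∈ad b∈ad)
    b≢d : b ≢ d
    b≢d refl = b∉ad d∈ad
    c≢d : c ≢ d
    c≢d refl = a≢b (proj₁ (noTriangle d∉ab d∈ad a∈ad a∈ab c∈bc b∈bc b∈ab))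
    d∉bc : ¬ d I bc
    d∉bc d∈bc = Sum.[ b≢d ∘ sym , c≢d ∘ sym ] (on-bc d∈bc)
    b∉cd : ¬ b I cd
    b∉cd b∈cd = Sum.[ (λ { refl → d∉ab d∈cd }) , (λ { refl → d∉bc d∈cd }) ] (through-b b∈cd)
    b,d-apart : ∀ {M} → b I M → ¬ d I M
    b,d-apart bM dM = Sum.[ (λ { refl → d∉ab dM }) , (λ { refl → d∉bc dM }) ] (through-b bM)

module _ {S G} (QS : Quadrangle S) (QG : Quadrangle G) (orderG : HasOrder G 1 1)
         (Φ : Morphism S G) (epi : IsEpimorphism Φ) where
  open Quadrangle QS
  open Geometry S using (_I_; _~_)
  open Geometry G using () renaming (_I_ to _IG_)

  private
    φ = onPoints Φ
    ψ = onLines Φ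

    at : ∀ {x M v K} → x I M → φ x ≡ v → ψ M ≡ K → v IG K
    at xM refl refl = preserves Φ xM

  module Fibres (Q : Square G) {L} (ψL : ψ L ≡ Square.ab Q)
                (L! : ∀ {M} → ψ M ≡ Square.ab Q → M ≡ L) where
    open Square Q
    open Incidences QG orderG Q
    private
      module M = Incidences QG orderG (mirror Q)
      c∉ab = M.d∉ab
      a∉bc = M.b∉ad

    -- Project `x` onto `M`. The projecting line lies over `ab` or `ad`, the projection over `b` or
    -- `c`, and the only incident combination is `ab` with `b`. As `L` is alone over `ab`, it is the
    -- projecting line.
    across : ∀ {x M} → φ x ≡ a → ψ M ≡ bc → x I L × ∃[ y ] φ y ≡ b × y I M
    across {x} {M} φx ψM with project {x} {M} (λ xM → a∉bc (at xM φx ψM))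
    ... | y , N , xN , yN , yM with through-a (at xN φx refl) | on-bc (at yM refl ψM)
    ...   | inj₁ ψN | inj₁ φy = subst (x I_) (L! ψN) xN , y , φy , yM
    ...   | inj₁ ψN | inj₂ φy = contradiction (at yN φy ψN) c∉ab
    ...   | inj₂ ψN | inj₁ φy = contradiction (at yN φy ψN) b∉ad
    ...   | inj₂ ψN | inj₂ φy = contradiction (at yN φy ψN) M.d∉bc

    over-a : ∀ {x} → φ x ≡ a → x I L
    over-a φx = proj₁ (across φx (proj₂ (preimage (proj₂ epi) bc)))

    bc-meets-B : ∀ {M} → ψ M ≡ bc → ∃[ y ] φ y ≡ b × y I M
    bc-meets-B ψM = proj₂ (across (proj₂ (preimage (proj₁ epi) a)) ψM)

    -- The projection of `x` onto `L` lies over `a` or `b`, and `b` is impossible because `b` and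
    -- `d` are not collinear.
    over-d : ∀ {x} → φ x ≡ d → ¬ x I L × ∃[ y ] φ y ≡ a × x ~ y
    over-d {x} φx = x∉L , nearest
      where
      x∉L : ¬ x I L
      x∉L xL = d∉ab (at xL φx ψL)
      nearest : ∃[ y ] φ y ≡ a × x ~ y
      nearest with project x∉L
      ... | y , N , xN , yN , yL with on-ab (at yL refl ψL)
      ...   | inj₁ φy = y , φy , N , xN , yN
      ...   | inj₂ φy = contradiction (at xN φx refl) (b,d-apart (at yN φy refl))

    near-A : ∀ {x y} → ¬ x I L → φ y ≡ a → x ~ y → φ x ≡ d
    near-A x∉L φy (N , xN , yN) with through-a (at yN φy refl)
    ... | inj₁ ψN = contradiction (subst (_ I_) (L! ψN) xN) x∉L
    ... | inj₂ ψN = Sum.fromInj₂ (λ φx → contradiction (over-a φx) x∉L) (on-ad (at xN refl ψN))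

    through-A : ∀ {M y} → M ≢ L → φ y ≡ a → y I M → ψ M ≡ ad
    through-A M≢L φy yM = Sum.fromInj₂ (λ ψM → contradiction (L! ψM) M≢L) (through-a (at yM φy refl))

    -- A point over `b` is projected onto `M`; the projection cannot lie over `d`, which is not
    -- collinear with `b`.
    cd-meets-C : ∀ {M} → ψ M ≡ cd → ∃[ x ] φ x ≡ c × x I M
    cd-meets-C {M} ψM with preimage (proj₁ epi) b
    ... | y , φy with project {y} {M} (λ yM → b∉cd (at yM φy ψM))
    ...   | z , N , yN , zN , zM with on-cd (at zM refl ψM)
    ...     | inj₁ φz = z , φz , zM
    ...     | inj₂ φz = contradiction (at zN φz refl) (b,d-apart (at yN φy refl))

  line-fibre⇒AsInA : ∀ {s} → (∀ M → HasSize (Geometry.pointsOn S M) (suc s)) →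
                     ∀ {L} → (∀ {M} → ψ M ≡ ψ L → M ≡ L) → AsInA s Φ
  line-fibre⇒AsInA {s} sizes {L} L! with squareOn QG orderG (ψ L)
  ... | Q , refl = record
    { a = a ; b = b ; c = c ; d = d
    ; a≢b = a≢b ; a≢c = I′.b≢d ; a≢d = a≢d ; b≢c = b≢c ; b≢d = I.b≢d ; c≢d = I.c≢d
    ; allPoints = allPoints
    ; ab = ab ; bc = bc ; cd = cd ; ad = ad
    ; joins-ab = a∈ab , b∈ab ; joins-bc = b∈bc , c∈bc ; joins-cd = c∈cd , d∈cd ; joins-ad = a∈ad , d∈ad
    ; L = L
    ; sizeÃ = proper-part (sizes L) (λ x → Quadrangle._≟ₚ_ QG (φ x) a) F.over-a
                (proj₂ A) (F′.over-a (proj₂ B)) (λ φ≡a → a≢b (trans (sym φ≡a) (proj₂ B)))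
    ; sizeB̃ = proper-part (sizes L) (λ x → Quadrangle._≟ₚ_ QG (φ x) b) F′.over-a
                (proj₂ B) (F.over-a (proj₂ A)) (λ φ≡b → a≢b (trans (sym (proj₂ A)) φ≡b))
    ; partition-covers = (λ xL → on-ab (preserves Φ xL)) , Sum.[ F.over-a , F′.over-a ]
    ; partition-disjoint = λ (φx≡a , φx≡b) → a≢b (trans (sym φx≡a) φx≡b)
    ; fibre-c = F′.over-d , λ (x∉L , y , φy , x~y) → F′.near-A x∉L φy x~y
    ; fibre-d = F.over-d , λ (x∉L , y , φy , x~y) → F.near-A x∉L φy x~y
    ; fibre-ab = L! , cong ψ
    ; fibre-bc = (λ ψM → (λ { refl → ab≢bc ψM }) , F.bc-meets-B ψM) ,
                 λ (M≢L , y , φy , yM) → F′.through-A M≢L φy yM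
    ; fibre-ad = (λ ψM → (λ { refl → ab≢ad ψM }) , F′.bc-meets-B ψM) ,
                 λ (M≢L , y , φy , yM) → F.through-A M≢L φy yM
    ; fibre-cd = (λ ψM → F.cd-meets-C ψM , F′.cd-meets-C ψM) ,
                 λ ((x , φx , xM) , (y , φy , yM)) →
                   Quadrangle.join QG I.c≢d (at xM φx refl) (at yM φy refl) c∈cd d∈cd
    }
    where
    open Square Q
    module I = Incidences QG orderG Q
    module I′ = Incidences QG orderG (mirror Q)
    module F = Fibres Q refl L!
    module F′ = Fibres (mirror Q) refl L!

    A = preimage (proj₁ epi) a
    B = preimage (proj₁ epi) b

    allPoints : ∀ x → x ≡ a ⊎ x ≡ b ⊎ x ≡ c ⊎ x ≡ d
    allPoints x with Quadrangle._I?_ QG x ab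
    ... | yes x∈ab = Sum.map₂ inj₁ (on-ab x∈ab)
    ... | no x∉ab with Quadrangle.project QG x∉ab
    ...   | y , M , xM , yM , y∈ab with on-ab y∈ab
    ...     | inj₁ refl with through-a yM
    ...       | inj₁ refl = contradiction xM x∉ab
    ...       | inj₂ refl = Sum.map₂ (inj₂ ∘ inj₂) (on-ad xM)
    allPoints x | no x∉ab | y , M , xM , yM , y∈ab | inj₂ refl with through-b yM
    ...       | inj₁ refl = contradiction xM x∉ab
    ...       | inj₂ refl = inj₂ (Sum.map₂ inj₁ (on-bc xM))

-- Conclusion of the classification

atLeast≤size : {X : Set} {P : Pred X 0ℓ} → ∀ {m n} → HasAtLeast m P → HasSize P n → m ≤ n
atLeast≤size (g , g-inj , Pg) (f , _ , P⇔f) = Fin.injective⇒≤ {f = λ i → proj₁ (Equivalence.to (P⇔f _) (Pg i))}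
  λ {i} {j} eq → g-inj (trans (sym (proj₂ (Equivalence.to (P⇔f _) (Pg i))))
                        (trans (cong f eq) (proj₂ (Equivalence.to (P⇔f _) (Pg j)))))

flag : ∀ {G} → IsWeakGeneralizedPolygon 4 G → ∃₂ λ v H → Geometry._I_ G v H
flag weak = let (γ , _) = commonGon nonempty nonempty in
  _ , _ , preserves (SubGon.embedding γ) {# 0} {# 0} (inj₁ refl)
  where open IsWeakGeneralizedPolygon weak

finiteQuadrangle : ∀ {s t S} → IsFiniteThickGQ s t S → FiniteQuadrangle s t S
finiteQuadrangle {S = S} gq = let (x , L , _) = flag (proj₁ quadrangle) in record
  { quadrangle = polygon⇒quadrangle (proj₁ quadrangle) order
  ; finite = finite
  ; order = order
  ; 2≤s = s≤s⁻¹ (atLeast≤size (proj₂ (proj₂ quadrangle) L) (proj₁ order L))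
  ; 2≤t = s≤s⁻¹ (atLeast≤size (proj₁ (proj₂ quadrangle) x) (proj₂ order x))
  }
  where open IsFiniteThickGQ gq

epimorphism-class : ∀ {s t S G} → IsFiniteThickGQ s t S → ∀ s' → IsGrid s' G →
                    (Φ : Morphism S G) → IsEpimorphism Φ →
                    s' ≡ 1 × (AsInA s Φ ⊎ AsInA t (dualMorphism Φ))
epimorphism-class _ zero grid = contradiction (IsGrid.positive grid) λ ()
epimorphism-class gq (suc (suc k)) grid Φ epi =
  let (v , H , vH) = flag (IsGrid.weak grid) in
  ⊥-elim (no-large-grid (finiteQuadrangle gq) (polygon⇒quadrangle (IsGrid.weak grid) (IsGrid.order grid))
                        (IsGrid.order grid) Φ epi vH)
epimorphism-class {s} {t} {S} {G} gq 1 grid Φ epi = refl , classify (singleton-class F D)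
  where
  open IsGrid grid
  F = finiteQuadrangle gq
  QS = FiniteQuadrangle.quadrangle F
  QG = polygon⇒quadrangle weak order
  gridSplit : Split G
  gridSplit = cornerSplit QG order (proj₂ (corner QG order (proj₂ (proj₂ (flag weak)))))
  module G = Split gridSplit
  D : Split S
  D = pullback Φ epi gridSplit
  open Split D

  thin-line : ∀ {L} → (∀ {M} → onLines Φ M ≡ onLines Φ L → M ≡ L) → AsInA s Φ
  thin-line = line-fibre⇒AsInA QS QG order Φ epi (proj₁ (FiniteQuadrangle.order F))

  thin-point : ∀ {x} → (∀ {y} → onPoints Φ y ≡ onPoints Φ x → y ≡ x) → AsInA t (dualMorphism Φ)
  thin-point = line-fibre⇒AsInA (dualQuadrangle QS) (dualQuadrangle QG) (swap order)
                 (dualMorphism Φ) (swap epi) (proj₂ (FiniteQuadrangle.order F))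

  classify : SingletonClass F D → AsInA s Φ ⊎ AsInA t (dualMorphism Φ)
  -- The class contains the whole fibre of the image of `L`, so a singleton class makes that fibre a
  -- singleton.
  classify (inj₁ (i , unique)) = let (L , Li) = rowLine i in
    inj₁ (thin-line λ eq → unique (subst (G.Row i) (sym eq) Li) Li)
  classify (inj₂ (inj₁ (j , unique))) = let (L , Lj) = colLine j in
    inj₁ (thin-line λ eq → unique (subst (G.Col j) (sym eq) Lj) Lj)
  classify (inj₂ (inj₂ (i , j , unique))) = let (x , xij) = point i j in
    inj₂ (thin-point λ eq → unique (subst (λ v → G.row v ≡ i × G.col v ≡ j) (sym eq) xij) xij)

-- The Ahrens–Szekeres quadrangle of order (2 , 4)

𝔽₃ = Fin 3

infixl 6 _⊕_
infixl 7 _⊗_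
infix  8 ⊖_

successor : 𝔽₃ → 𝔽₃
successor zero             = # 1
successor (suc zero)       = # 2
successor (suc (suc zero)) = # 0

_⊕_ _⊗_ : 𝔽₃ → 𝔽₃ → 𝔽₃
zero           ⊕ b = b
suc zero       ⊕ b = successor b
suc (suc zero) ⊕ b = successor (successor b)
zero           ⊗ b = zero
suc zero       ⊗ b = b
suc (suc zero) ⊗ b = b ⊕ b

⊖_ : 𝔽₃ → 𝔽₃
⊖ a = # 2 ⊗ a

ASPoint ASLine : Set
ASPoint = 𝔽₃ × 𝔽₃ × 𝔽₃
ASLine  = Fin 5 × 𝔽₃ × 𝔽₃

-- For q = 3 the Ahrens–Szekeres lines are {(σ , a , b)}, {(a , σ , b)} and, for every c,
-- {(cσ² − bσ + a , −2cσ + b , σ)}; here −2c = c.  A line (k , a , b) of kind k = 2 + c is of the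
-- last form, and through k x gives the parameters a , b of the line of kind k on x.
through : Fin 5 → ASPoint → 𝔽₃ × 𝔽₃
through zero          (x , y , z) = y , z
through (suc zero)    (x , y , z) = x , z
through (suc (suc c)) (x , y , z) = x ⊕ y ⊗ z ⊕ c ⊗ (z ⊗ z) , y ⊕ ⊖ (c ⊗ z)

trace : ASLine → 𝔽₃ → ASPoint
trace (zero , a , b)        σ = σ , a , b
trace (suc zero , a , b)    σ = a , σ , b
trace (suc (suc c) , a , b) σ = c ⊗ (σ ⊗ σ) ⊕ ⊖ (b ⊗ σ) ⊕ a , c ⊗ σ ⊕ b , σ

parameter : Fin 5 → ASPoint → 𝔽₃
parameter zero          (x , y , z) = x
parameter (suc zero)    (x , y , z) = y
parameter (suc (suc c)) (x , y , z) = z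

-- The lines of each kind partition the points, so incidence is an equation of parameters and a
-- point has exactly one line of each of the five kinds.
AS : Geometry
AS = record { Point = ASPoint ; Line = ASLine ; _I_ = λ x (k , ab) → through k x ≡ ab }

_≟²_ : (p q : 𝔽₃ × 𝔽₃) → Dec (p ≡ q)
_≟²_ = ≡-dec Fin._≟_ Fin._≟_

_≟ᴾ_ : (x y : ASPoint) → Dec (x ≡ y)
_≟ᴾ_ = ≡-dec Fin._≟_ _≟²_

_≟ᴸ_ : (L M : ASLine) → Dec (L ≡ M)
_≟ᴸ_ = ≡-dec Fin._≟_ _≟²_

all³? : {P : Pred ASPoint 0ℓ} → Decidable P → Dec (∀ x → P x)
all³? P? = map′ (λ f (x , y , z) → f x y z) (λ f x y z → f (x , y , z))
  (Fin.all? λ x → Fin.all? λ y → Fin.all? λ z → P? (x , y , z))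

all²? : {P : Pred (𝔽₃ × 𝔽₃) 0ℓ} → Decidable P → Dec (∀ x → P x)
all²? P? = map′ (λ f (x , y) → f x y) (λ f x y → f (x , y)) (Fin.all? λ x → Fin.all? λ y → P? (x , y))

abstract
  through-trace : ∀ k ab σ → through k (trace (k , ab) σ) ≡ ab
  through-trace = from-yes (Fin.all? λ k → all²? λ ab → Fin.all? λ σ → through k (trace (k , ab) σ) ≟² ab)

  trace-parameter : ∀ k x → trace (k , through k x) (parameter k x) ≡ x
  trace-parameter = from-yes (Fin.all? λ k → all³? λ x → trace (k , through k x) (parameter k x) ≟ᴾ x)

  parameter-trace : ∀ k ab σ → parameter k (trace (k , ab) σ) ≡ σ
  parameter-trace = from-yes (Fin.all? λ k → all²? λ ab → Fin.all? λ σ → parameter k (trace (k , ab) σ) Fin.≟ σ)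

  -- The second point is written as a point of the line of kind `k` on `x`. The collinearity
  -- hypothesis thus becomes the range of `σ`, which keeps the search small.
  linear-check : ∀ x k σ l → through l x ≡ through l (trace (k , through k x) σ) →
                 x ≡ trace (k , through k x) σ ⊎ k ≡ l
  linear-check = from-yes (all³? λ x → Fin.all? λ k → Fin.all? λ σ → Fin.all? λ l →
    (through l x ≟² through l (trace (k , through k x) σ)) →-dec
    ((x ≟ᴾ trace (k , through k x) σ) ⊎-dec (k Fin.≟ l)))

  project-check : ∀ x k ab → ∃₂ λ σ l → through l x ≡ through l (trace (k , ab) σ)
  project-check = from-yes (all³? λ x → Fin.all? λ k → all²? λ ab → Fin.any? λ σ → Fin.any? λ l →
    through l x ≟² through l (trace (k , ab) σ))

  triangle-check : ∀ k l m → k ≡ l ⊎ m ≡ k ⊎ m ≡ l ⊎ (∀ x σ τ →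
    x ≡ trace (k , through k x) σ ⊎ x ≡ trace (l , through l x) τ ⊎
    through m (trace (k , through k x) σ) ≢ through m (trace (l , through l x) τ))
  -- The degenerate triples of kinds are decided first, which prunes the exhaustive search.
  triangle-check = toWitness {a? = Fin.all? λ k → Fin.all? λ l → Fin.all? λ m →
    (k Fin.≟ l) ⊎-dec (m Fin.≟ k) ⊎-dec (m Fin.≟ l) ⊎-dec
    (all³? λ x → Fin.all? λ σ → Fin.all? λ τ →
      (x ≟ᴾ trace (k , through k x) σ) ⊎-dec (x ≟ᴾ trace (l , through l x) τ) ⊎-dec
      ¬? (through m (trace (k , through k x) σ) ≟² through m (trace (l , through l x) τ)))} tt

on-trace : ∀ {k x y} → through k x ≡ through k y → trace (k , through k x) (parameter k y) ≡ y
on-trace {k} {x} {y} eq = trans (cong (λ ab → trace (k , ab) (parameter k y)) eq) (trace-parameter k y)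

AS-linear : ∀ {x y L M} → let open Geometry AS using (_I_) in x I L → y I L → x I M → y I M → x ≡ y ⊎ L ≡ M
AS-linear {x} {y} {k , _} {l , _} refl yL refl yM
  with linear-check x k (parameter k y) l (trans (sym yM) (cong (through l) (sym (on-trace (sym yL)))))
... | inj₁ x≡y  = inj₁ (trans x≡y (on-trace (sym yL)))
... | inj₂ refl = inj₂ refl

ahrensSzekeres : Quadrangle AS
ahrensSzekeres = record
  { _≟ₚ_ = _≟ᴾ_
  ; _≟ₗ_ = _≟ᴸ_
  ; _I?_ = λ x (k , ab) → through k x ≟² ab
  ; linear = AS-linear
  ; project = λ { {x} {k , ab} _ → let (σ , l , eq) = project-check x k ab in
      trace (k , ab) σ , (l , through l x) , refl , sym eq , through-trace k ab σ }
  ; noTriangle = no-triangle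
  }
  where
  open Geometry AS using (_I_)
  no-triangle : ∀ {x L y z M N} → ¬ x I L →
                x I M → y I M → y I L → x I N → z I N → z I L → y ≡ z × M ≡ N
  no-triangle {x} {m , _} {y} {z} {k , _} {l , _} x∉L refl yM refl refl zN zL
    with triangle-check k l m
  -- Lines of the same kind with a common point are equal, so `x` would lie on `L`.
  ... | inj₂ (inj₁ refl) = contradiction (sym yM) x∉L
  ... | inj₂ (inj₂ (inj₁ refl)) = contradiction (trans (sym zN) zL) x∉L
  ... | inj₁ refl with AS-linear {y} {z} {k , through k x} {m , through m y} yM zN refl zL
  ...   | inj₁ y≡z = y≡z , refl
  ...   | inj₂ M≡L = contradiction (subst (x I_) M≡L refl) x∉L
  no-triangle {x} {m , _} {y} {z} {k , _} {l , _} x∉L refl yM refl refl zN zL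
      | inj₂ (inj₂ (inj₂ check)) with check x (parameter k y) (parameter l z)
  ...   | inj₁ x≡y = contradiction (cong (through m) (trans x≡y (on-trace (sym yM)))) x∉L
  ...   | inj₂ (inj₁ x≡z) = contradiction (trans (cong (through m) (trans x≡z (on-trace (sym zN)))) zL) x∉L
  ...   | inj₂ (inj₂ apart) = contradiction
    (trans (cong (through m) (on-trace (sym yM))) (trans (sym zL) (cong (through m) (sym (on-trace (sym zN)))))) apart

finite-× : {X Y : Set} → Finite X → Finite Y → Finite (X × Y)
finite-× (m , e) (n , f) = _ , (↔-sym (Fin.*↔× {m} {n}) ↔-∘ (e ×-↔ f))

size-lines : ∀ x → HasSize (Geometry.linesThrough AS x) 5
size-lines x = (λ k → k , through k x) , cong proj₁ , λ (k , ab) →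
  mk⇔ (λ { refl → k , refl }) (λ { (l , refl) → refl })

size-points : ∀ L → HasSize (Geometry.pointsOn AS L) 3
size-points (k , ab) = trace (k , ab) ,
  (λ {σ} {τ} eq → trans (sym (parameter-trace k ab σ)) (trans (cong (parameter k) eq) (parameter-trace k ab τ))) ,
  λ x → mk⇔ (λ { refl → parameter k x , trace-parameter k x }) (λ { (σ , refl) → through-trace k ab σ })

finiteAS : FiniteQuadrangle 2 4 AS
finiteAS = record
  { quadrangle = ahrensSzekeres
  ; finite = finite-× (finiteFin 3) (finite-× (finiteFin 3) (finiteFin 3))
           , finite-× (finiteFin 5) (finite-× (finiteFin 3) (finiteFin 3))
  ; order = size-points , size-lines
  ; 2≤s = s≤s (s≤s z≤n)
  ; 2≤t = s≤s (s≤s z≤n)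
  }

size⇒atLeast : {X : Set} {P : Pred X 0ℓ} → ∀ {m n} → m ≤ n → HasSize P n → HasAtLeast m P
size⇒atLeast m≤n (f , f-inj , P⇔f) = (λ i → f (inject≤ i m≤n)) ,
  (λ {i} {j} eq → Fin.inject≤-injective m≤n m≤n i j (f-inj eq)) ,
  λ i → Equivalence.from (P⇔f _) (_ , refl)

size-pair : {X : Set} {P : Pred X 0ℓ} → ∀ x y → x ≢ y → (∀ z → P z → z ≡ x ⊎ z ≡ y) → P x → P y → HasSize P 2
size-pair {X} {P} x y x≢y only Px Py = pair , injective , λ z → mk⇔
  (λ Pz → index z (only z Pz))
  (λ { (zero , refl) → Px ; (suc zero , refl) → Py })
  where
  pair : Fin 2 → X
  pair zero    = x
  pair (suc _) = y
  index : ∀ z → z ≡ x ⊎ z ≡ y → ∃[ i ] pair i ≡ z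
  index z (inj₁ z≡x) = # 0 , sym z≡x
  index z (inj₂ z≡y) = # 1 , sym z≡y
  injective : Injective _≡_ _≡_ pair
  injective {zero}     {zero}     _  = refl
  injective {zero}     {suc zero} eq = contradiction eq x≢y
  injective {suc zero} {zero}     eq = contradiction (sym eq) x≢y
  injective {suc zero} {suc zero} _  = refl

ordinaryOrder : HasOrder (ordinaryGon 4) 1 1
ordinaryOrder =
  (λ j → size-pair j (cyclicSuc j) (next≢ j) (λ _ → id) (inj₁ refl) (inj₂ refl)) ,
  (λ i → size-pair i (previous i) (previous≢ i) (λ j → Sum.map sym (before i j)) (inj₁ refl) (inj₂ (next-previous i)))
  where
  previous : Fin 4 → Fin 4
  previous i = cyclicSuc (cyclicSuc (cyclicSuc i))
  next≢ : ∀ i → i ≢ cyclicSuc i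
  next≢ = from-yes (Fin.all? {n = 4} λ i → ¬? (i Fin.≟ cyclicSuc i))
  previous≢ : ∀ i → i ≢ previous i
  previous≢ = from-yes (Fin.all? λ i → ¬? (i Fin.≟ previous i))
  next-previous : ∀ i → i ≡ cyclicSuc (previous i)
  next-previous = from-yes (Fin.all? λ i → i Fin.≟ cyclicSuc (previous i))
  before : ∀ i j → i ≡ cyclicSuc j → j ≡ previous i
  before = from-yes (Fin.all? λ i → Fin.all? λ j → (i Fin.≟ cyclicSuc j) →-dec (j Fin.≟ previous i))

ontoGrid : ∀ {s t S G} → FiniteQuadrangle (suc s) (suc t) S → Element S →
           Quadrangle G → HasOrder G 1 1 → Element G → Point G → (Φ : Morphism S G) → IsEpimorphism Φ → GQOntoGrid
ontoGrid {s} {t} {S} {G} F e QG orderG e′ v Φ epi = record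
  { S = S ; s = suc s ; t = suc t
  ; isGQ = record
    { finite = finite
    ; quadrangle = quadrangle⇒polygon quadrangle order e ,
                   (λ x → size⇒atLeast (s≤s 2≤t) (proj₂ order x)) , (λ L → size⇒atLeast (s≤s 2≤s) (proj₁ order L))
    ; order = order }
  ; G = G ; s' = 1
  ; isGrid = record
    { positive = s≤s z≤n
    ; weak = quadrangle⇒polygon QG orderG e′
    ; notThick = λ (thick , _) → case atLeast≤size (thick v) (proj₂ orderG v) of λ { (s≤s (s≤s ())) }
    ; order = orderG }
  ; Φ = Φ ; epi = epi }
  where open FiniteQuadrangle F

-- In (a) the fibre of `ab` is a single line.
thick-fibres⇒¬AsInA : ∀ {S G s} (Φ : Morphism S G) →
  (∀ K → ∃₂ λ L M → onLines Φ L ≡ K × onLines Φ M ≡ K × L ≢ M) → ¬ AsInA s Φ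
thick-fibres⇒¬AsInA Φ two A =
  let (L , M , ΦL , ΦM , L≢M) = two (AsInA.ab A)
  in L≢M (trans (proj₁ (AsInA.fibre-ab A) ΦL) (sym (proj₁ (AsInA.fibre-ab A) ΦM)))

-- An epimorphism of this quadrangle onto the ordinary quadrangle

origin : ASPoint
origin = # 0 , # 0 , # 0

-- The partition of the five lines on the origin into two and three; neither part is a singleton.
half : Fin 5 → Fin 2
half zero          = # 0
half (suc zero)    = # 0
half (suc (suc _)) = # 1

-- The dual of (a) with the origin in the role of `L`: vertices 1 and 3 receive the other points on
-- the lines of the two parts, and the opposite vertex 2 the points not collinear with the origin.
vertex : ASPoint → Fin 4
vertex x with x ≟ᴾ origin | Fin.any? (λ k → (half k Fin.≟ # 0) ×-dec (through k x ≟² (# 0 , # 0)))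
                          | Fin.any? (λ k → (half k Fin.≟ # 1) ×-dec (through k x ≟² (# 0 , # 0)))
... | yes _ | _     | _     = # 0
... | no _  | yes _ | _     = # 1
... | no _  | no _  | yes _ = # 3
... | no _  | no _  | no _  = # 2

-- Lines on the origin go to the sides 0 and 3 at vertex 0. Any other line has exactly one point
-- collinear with the origin, and the vertex of that point decides between sides 1 and 2.
side : ASLine → Fin 4
side (k , ab) with ab ≟² (# 0 , # 0) | half k | Fin.any? (λ σ → vertex (trace (k , ab) σ) Fin.≟ # 1)
... | yes _ | zero  | _     = # 0
... | yes _ | suc _ | _     = # 3
... | no _  | _     | yes _ = # 1
... | no _  | _     | no _  = # 2

abstract
  vertex-on-side : ∀ x k → vertex x ≡ side (k , through k x) ⊎ vertex x ≡ cyclicSuc (side (k , through k x))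
  vertex-on-side = from-yes (all³? λ x → Fin.all? λ k →
    (vertex x Fin.≟ side (k , through k x)) ⊎-dec (vertex x Fin.≟ cyclicSuc (side (k , through k x))))

  origin-unique : ∀ x → vertex x ≡ # 0 → x ≡ origin
  origin-unique = from-yes (all³? λ x → (vertex x Fin.≟ # 0) →-dec (x ≟ᴾ origin))

Φ₀ : Morphism AS (ordinaryGon 4)
Φ₀ = record { onPoints = vertex ; onLines = side ; preserves = λ { {x} {k , _} refl → vertex-on-side x k } }

vertex-preimage : ∀ i → ∃[ x ] vertex x ≡ i
vertex-preimage = λ
  { zero → origin , refl
  ; (suc zero) → (# 1 , # 0 , # 0) , refl
  ; (suc (suc zero)) → (# 1 , # 1 , # 0) , refl
  ; (suc (suc (suc zero))) → (# 0 , # 0 , # 1) , refl }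

abstract
  two-lines : ∀ j → ∃₂ λ L M → side L ≡ j × side M ≡ j × L ≢ M
  two-lines = λ
    { zero → (# 0 , # 0 , # 0) , (# 1 , # 0 , # 0) , refl , refl , λ ()
    ; (suc zero) → (# 1 , # 1 , # 0) , (# 1 , # 2 , # 0) , refl , refl , λ ()
    ; (suc (suc zero)) → (# 0 , # 0 , # 1) , (# 1 , # 0 , # 1) , refl , refl , λ ()
    ; (suc (suc (suc zero))) → (# 2 , # 0 , # 0) , (# 3 , # 0 , # 0) , refl , refl , λ () }

Φ₀-epi : IsEpimorphism Φ₀
Φ₀-epi = (λ i → let (x , eq) = vertex-preimage i in x , λ { refl → eq }) ,
         (λ j → let (L , _ , eq , _) = two-lines j in L , λ { refl → eq })

exampleB exampleA : GQOntoGrid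
exampleB = ontoGrid finiteAS (inj₁ origin) ordinaryQuadrangle ordinaryOrder (inj₁ (# 0)) (# 0) Φ₀ Φ₀-epi
exampleA = ontoGrid (dualFinite finiteAS) (inj₂ origin) (dualQuadrangle ordinaryQuadrangle) (swap ordinaryOrder)
                    (inj₁ (# 0)) (# 0) (dualMorphism Φ₀) (swap Φ₀-epi)

origin-fibre : AsInA 4 (dualMorphism Φ₀)
origin-fibre = line-fibre⇒AsInA (dualQuadrangle ahrensSzekeres) (dualQuadrangle ordinaryQuadrangle)
  (swap ordinaryOrder) (dualMorphism Φ₀) (swap Φ₀-epi) size-lines {origin} (λ {x} → origin-unique x)

no-line-fibre : ¬ AsInA 2 Φ₀
no-line-fibre = thick-fibres⇒¬AsInA Φ₀ two-lines

theorem4p1 :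
    (∀ (E : GQOntoGrid) → GQOntoGrid.s' E ≡ 1 × (ClassA E ⊎ ClassB E))
    × (∃[ E ] (ClassA E × ¬ ClassB E))
    × (∃[ E ] (ClassB E × ¬ ClassA E))
theorem4p1 =
  (λ E → let open GQOntoGrid E in epimorphism-class isGQ s' isGrid Φ epi) ,
  -- Dualizing `Φ₀` twice gives `Φ₀` back by definition, so the same two facts serve both examples
  -- with the roles of the classes exchanged.
  (exampleA , origin-fibre , no-line-fibre) ,
  (exampleB , origin-fibre , no-line-fibre)
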